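{- Let $G$ and $H$ be connected graphs and $k\ge1$ an integer with $k\le\kappa(G)$, $|V(G)|\ge 2k-1$, and $\lambda(G)\ge (k-1)\lambda(H)$. (i) If $k|V(H)|\le |V(G)|\lambda(H)$ and $\mathrm{gon}(G)=k$, then $\mathrm{sn}(G\square H)=\mathrm{gon}(G\square H)=k|V(H)|$. (ii) If $|V(G)|\lambda(H)\le k|V(H)|$ and $\mathrm{gon}(H)=\lambda(H)$, then $\mathrm{sn}(G\square H)=\mathrm{gon}(G\square H)=|V(G)|\lambda(H)$.
   Context: Graphs are finite, multiple edges allowed, no loops. $\kappa$ is vertex-connectivity, $\lambda$ edge-connectivity (edges with multiplicity). $G\square H$ is the Cartesian product (vertex set $V(G)\times V(H)$; $(u_1,v_1),(u_2,v_2)$ joined by $e$ edges iff $u_1=u_2$ and $v_1,v_2$ joined by $e$ edges in $H$, or $v_1=v_2$ and $u_1,u_2$ joined by $e$ edges in $G$). Scramble number $\mathrm{sn}$: a scramble is a finite collection of nonempty vertex sets (eggs) each inducing a connected subgraph; its order is $\min(h,e)$ where $h$ is the minimum size of a vertex set meeting every egg and $e$ is the minimum of $|E(A,A^C)|$ over $A\subseteq V$ containing some egg whose complement contains some egg ($+\infty$ if none); $\mathrm{sn}$ is the maximum order. Gonality: a divisor is an integer combination of vertices; firing a vertex $w$ removes $\mathrm{val}(w)$ chips from $w$ and gives each other vertex one chip per edge to $w$; divisors are equivalent if related by firings; $D$ has positive rank if $D-(v)$ is equivalent to an effective divisor for every vertex $v$; $\mathrm{gon}$ is the minimum degree of a positive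 rank divisor. -}

module Defs where

open import Data.Nat as ℕ using (ℕ; zero; suc; _+_; _*_; _≤_; _<_; _⊓_)
open import Data.Integer as ℤ using (ℤ; +_; _-_)
import Data.Empty
import Relation.Binary.PropositionalEquality
open import Data.Bool using (Bool; true; false; if_then_else_; _∧_; not)
open import Data.Fin using (Fin; remQuot)
open import Data.Fin.Properties using (_≟_)
open import Data.Fin.Subset using (Subset; _∈_; _∉_; ∣_∣; Nonempty; ⊤; ∁)
import Data.Vec
open import Data.Vec using (Vec; lookup; tabulate)
open import Data.List using (List)
open import Data.List.Relation.Unary.All using (All)
open import Data.List.Relation.Unary.Any using (Any)
open import Data.Product using (Σ; ∃; _×_; _,_; proj₁; proj₂)
open import Data.Sum using (_⊎_)
open import Relation.Nullary using (¬_; does; yes; no)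
open import Relation.Binary.PropositionalEquality using (_≡_; refl)
open import Relation.Binary.Construct.Closure.ReflexiveTransitive using (Star)

-- Finite multigraphs without loops, vertex set Fin n,
-- adj u v = number of edges between u and v.

record Graph : Set where
  field
    n        : ℕ
    adj      : Fin n → Fin n → ℕ
    adj-sym  : ∀ u v → adj u v ≡ adj v u
    loopless : ∀ u → adj u u ≡ 0
open Graph public

∣V∣ : Graph → ℕ
∣V∣ = n

∑ : ∀ {k} → (Fin k → ℕ) → ℕ
∑ f = Data.Vec.sum (tabulate f)

∑ℤ : ∀ {k} → (Fin k → ℤ) → ℤ
∑ℤ {zero}  f = + 0
∑ℤ {suc k} f = f Fin.zero ℤ.+ ∑ℤ (λ i → f (Fin.suc i))

val : (G : Graph) → Fin (n G) → ℕ
val G w = ∑ (adj G w)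

data Reach (G : Graph) (S : Subset (n G)) : Fin (n G) → Fin (n G) → Set where
  here : ∀ {u} → u ∈ S → Reach G S u u
  step : ∀ {u w v} → u ∈ S → 0 < adj G u w → Reach G S w v → Reach G S u v

InducesConnected : (G : Graph) → Subset (n G) → Set
InducesConnected G S =
  Nonempty S × (∀ u v → u ∈ S → v ∈ S → Reach G S u v)

Connected : Graph → Set
Connected G = InducesConnected G ⊤

cut : (G : Graph) → Subset (n G) → ℕ
cut G A = ∑ λ u → ∑ λ v →
  if lookup A u ∧ not (lookup A v) then adj G u v else 0

-- Vertex connectivity (Diestel): G is k-connected iff |V| > k and G - X is
-- connected for all X with |X| < k; κ(G) is the greatest such k.

KConnected : Graph → ℕ → Set
KConnected G k = k < n G × (∀ (X : Subset (n G)) → ∣ X ∣ < k → InducesConnected G (∁ X))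

IsVertexConnectivity : Graph → ℕ → Set
IsVertexConnectivity G κ = KConnected G κ × ¬ KConnected G (suc κ)

ProperNonempty : (G : Graph) → Subset (n G) → Set
ProperNonempty G A = Nonempty A × Nonempty (∁ A)

IsEdgeConnectivity : Graph → ℕ → Set
IsEdgeConnectivity G l =
  (n G ≤ 1 × l ≡ 0)
  ⊎ (2 ≤ n G
     × (∃ λ A → ProperNonempty G A × cut G A ≡ l)
     × (∀ A → ProperNonempty G A → l ≤ cut G A))

padj : (G H : Graph) → Fin (n G) → Fin (n H) → Fin (n G) → Fin (n H) → ℕ
padj G H u₁ v₁ u₂ v₂ =
  (if does (u₁ ≟ u₂) then adj H v₁ v₂ else 0)
  + (if does (v₁ ≟ v₂) then adj G u₁ u₂ else 0)

private
  ≟-sym : ∀ {k} (a b : Fin k) → does (a ≟ b) ≡ does (b ≟ a)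
  ≟-sym a b with a ≟ b | b ≟ a
  ... | yes _ | yes _ = refl
  ... | no _  | no _  = refl
  ... | yes p | no q  = Data.Empty.⊥-elim (q (Relation.Binary.PropositionalEquality.sym p))
  ... | no q  | yes p = Data.Empty.⊥-elim (q (Relation.Binary.PropositionalEquality.sym p))

  padj-sym : ∀ G H u₁ v₁ u₂ v₂ → padj G H u₁ v₁ u₂ v₂ ≡ padj G H u₂ v₂ u₁ v₁
  padj-sym G H u₁ v₁ u₂ v₂
    rewrite ≟-sym u₁ u₂ | ≟-sym v₁ v₂ | adj-sym H v₁ v₂ | adj-sym G u₁ u₂ = refl

  padj-loop : ∀ G H u v → padj G H u v u v ≡ 0
  padj-loop G H u v with u ≟ u | v ≟ v
  ... | yes _ | yes _ rewrite loopless H v | loopless G u = refl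
  ... | no q  | _     = Data.Empty.⊥-elim (q refl)
  ... | yes _ | no q  = Data.Empty.⊥-elim (q refl)

_□_ : Graph → Graph → Graph
G □ H = record
  { n = n G * n H
  ; adj = λ i j → padj G H (proj₁ (rq i)) (proj₂ (rq i)) (proj₁ (rq j)) (proj₂ (rq j))
  ; adj-sym = λ i j → padj-sym G H (proj₁ (rq i)) (proj₂ (rq i)) (proj₁ (rq j)) (proj₂ (rq j))
  ; loopless = λ i → padj-loop G H (proj₁ (rq i)) (proj₂ (rq i))
  }
  where
  rq : Fin (n G * n H) → Fin (n G) × Fin (n H)
  rq = remQuot {n G} (n H)

Scramble : Graph → Set
Scramble G = List (Subset (n G))

IsScramble : (G : Graph) → Scramble G → Set
IsScramble G S = All (InducesConnected G) S

Hits : (G : Graph) → Scramble G → Subset (n G) → Set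
Hits G S C = All (λ E → ∃ λ v → v ∈ E × v ∈ C) S

IsHittingNumber : (G : Graph) → Scramble G → ℕ → Set
IsHittingNumber G S h =
  (∃ λ C → Hits G S C × ∣ C ∣ ≡ h) × (∀ C → Hits G S C → h ≤ ∣ C ∣)

ContainsEgg : (G : Graph) → Scramble G → Subset (n G) → Set
ContainsEgg G S A = Any (λ E → ∀ v → v ∈ E → v ∈ A) S

Separates : (G : Graph) → Scramble G → Subset (n G) → Set
Separates G S A = ContainsEgg G S A × ContainsEgg G S (∁ A)

IsEggCut : (G : Graph) → Scramble G → ℕ → Set
IsEggCut G S e =
  (∃ λ A → Separates G S A × cut G A ≡ e) × (∀ A → Separates G S A → e ≤ cut G A)

-- order = min(h, e), with e = +∞ when no separating set exists
IsOrder : (G : Graph) → Scramble G → ℕ → Set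
IsOrder G S o = ∃ λ h → IsHittingNumber G S h ×
  (((∀ A → ¬ Separates G S A) × o ≡ h)
   ⊎ (∃ λ e → IsEggCut G S e × o ≡ h ⊓ e))

IsScrambleNumber : Graph → ℕ → Set
IsScrambleNumber G s =
  (∃ λ S → IsScramble G S × IsOrder G S s)
  × (∀ S o → IsScramble G S → IsOrder G S o → o ≤ s)

Divisor : Graph → Set
Divisor G = Fin (n G) → ℤ

deg : (G : Graph) → Divisor G → ℤ
deg G D = ∑ℤ D

fire : (G : Graph) → Fin (n G) → Divisor G → Divisor G
fire G w D u =
  if does (u ≟ w) then D u - + val G w else D u ℤ.+ + adj G u w

FireStep : (G : Graph) → Divisor G → Divisor G → Set
FireStep G D D′ = ∃ λ w → D′ ≡ fire G w D

Equivalent : (G : Graph) → Divisor G → Divisor G → Set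
Equivalent G = Star (FireStep G)

Effective : (G : Graph) → Divisor G → Set
Effective G D = ∀ v → + 0 ℤ.≤ D v

minusPoint : (G : Graph) → Divisor G → Fin (n G) → Divisor G
minusPoint G D v u = if does (u ≟ v) then D u - + 1 else D u

PositiveRank : (G : Graph) → Divisor G → Set
PositiveRank G D =
  ∀ v → ∃ λ E → Effective G E × Equivalent G (minusPoint G D v) E

IsGonality : Graph → ℕ → Set
IsGonality G g =
  (∃ λ D → PositiveRank G D × deg G D ≡ + g)
  × (∀ D → PositiveRank G D → + g ℤ.≤ deg G D)

{-# OPTIONS --safe #-}

-- Lower bound: for a divisor D of positive rank and a scramble of order o, o ≤ deg D.  Starting from an
-- effective divisor that misses some egg, fire level sets of a script that leads to a divisor with a chip on
-- that egg.  Either the set of eggs hit grows, or one of the level sets separates two eggs and its whole cut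
-- is paid for by chips of the current divisor.  In the end the support is a hitting set.
--
-- On G □ H take the eggs (V(G) ∖ X) × {v} with |X| < k.  A hitting set has at least k vertices in each copy of
-- G.  Two disjoint eggs lie in different copies of G since |V(G)| ≥ 2k − 1, and a set separating them
-- cuts at least |V(G)| λ(H) edges.  The matching divisors are pulled back along the projections of G □ H.

module Submission where

open import Defs
open import Algebra.Bundles using (CommutativeMonoid)
import Algebra.Properties.CommutativeMonoid.Sum as MonoidSum
import Algebra.Properties.Semiring.Sum as SemiringSum
open import Data.Bool using (Bool; true; false; if_then_else_; _∧_; not)
open import Data.Fin using (Fin; zero; suc; combine; remQuot; _↑ˡ_; _↑ʳ_)
open import Data.Fin.Properties using (_≟_; any?; all?; remQuot-combine; combine-remQuot)
open import Data.Fin.Subset using (Subset; _∈_; ∣_∣; ∁; ⊤; inside; outside)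
open import Data.Fin.Subset.Properties using (_∈?_; x∈∁p⇒x∉p; x∉p⇒x∈∁p; nonempty?; anySubset?; ∈⊤)
open import Data.Integer as ℤ using (ℤ; +_; 0ℤ; 1ℤ)
import Data.Integer.Properties as ℤ
open import Algebra.Properties.AbelianGroup ℤ.+-0-abelianGroup using (identityˡ-unique)
open import Data.Integer.Tactic.RingSolver using (solve-∀)
open import Data.List using (List; []; _∷_; _++_; map; filter; length; allFin; cartesianProductWith)
import Data.List.Membership.Propositional as List
import Data.List.Membership.Propositional.Properties as List
open import Data.List.Properties using (filter-notAll)
import Data.List.Relation.Unary.All as All
import Data.List.Relation.Unary.All.Properties as All
import Data.List.Relation.Unary.Any as Any
open import Data.Nat as ℕ using (ℕ; zero; suc; _+_; _*_; _∸_; _≤_; _<_; z≤n; s≤s)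
import Data.Nat.Properties as ℕ
open import Data.Product using (∃; _×_; _,_; proj₁; proj₂)
open import Data.Sum using (_⊎_; inj₁; inj₂)
import Data.Vec as Vec
open Vec using (lookup; tabulate)
open import Data.Vec.Properties using (lookup∘tabulate; []=⇒lookup; lookup⇒[]=)
open import Function using (_∘_; mk⇔)
open import Level using (0ℓ)
open import Relation.Binary.Construct.Closure.ReflexiveTransitive using (ε; _◅_; _◅◅_)
open import Relation.Binary.PropositionalEquality
open import Relation.Nullary using (¬_; Dec; does; yes; no; contradiction)
open import Relation.Nullary.Decidable using (dec-true; dec-false; does-⇔; decidable-stable; ¬?; _×-dec_; _→-dec_)

module ℕΣ = SemiringSum ℕ.+-*-semiring
module ℤΣ = SemiringSum ℤ.+-*-semiring

-- Finite sums

≟-does-sym : ∀ {m} (i j : Fin m) → does (i ≟ j) ≡ does (j ≟ i)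
≟-does-sym i j = does-⇔ (mk⇔ sym sym) (i ≟ j) (j ≟ i)

module FinSum (M : CommutativeMonoid 0ℓ 0ℓ) where
  open CommutativeMonoid M renaming (ε to 0#; refl to ≈-refl; sym to ≈-sym; trans to ≈-trans)
  open MonoidSum M

  sum-++ : ∀ m {k} (f : Fin (m + k) → Carrier) →
           sum f ≈ sum (λ i → f (i ↑ˡ k)) ∙ sum (λ j → f (m ↑ʳ j))
  sum-++ zero    f = ≈-sym (identityˡ _)
  sum-++ (suc m) f = ≈-trans (∙-congˡ (sum-++ m (f ∘ suc))) (≈-sym (assoc _ _ _))

  sum-combine : ∀ m {k} (f : Fin (m * k) → Carrier) →
                sum f ≈ sum (λ i → sum (λ j → f (combine {m} {k} i j)))
  sum-combine zero    f = ≈-refl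
  sum-combine (suc m) {k} f = ≈-trans (sum-++ k f) (∙-congˡ (sum-combine m (λ i → f (k ↑ʳ i))))

  sum-single : ∀ {m} (i : Fin m) (f : Fin m → Carrier) →
               sum (λ j → if does (i ≟ j) then f j else 0#) ≈ f i
  sum-single {suc m} zero    f = ≈-trans (∙-congˡ (sum-replicate-zero m)) (identityʳ _)
  sum-single {suc m} (suc i) f = ≈-trans (identityˡ _) (sum-single i (f ∘ suc))

  -- The form of every neighbour sum in a Cartesian product: the summand lives on a cross through
  -- `(u , v)`, and each arm collapses to a single sum by `sum-single`.
  sum-cross : ∀ {m k} (u : Fin m) (v : Fin k) (f g : Fin m → Fin k → Carrier) →
              sum (λ u′ → sum (λ v′ → (if does (u ≟ u′) then f u′ v′ else 0#)
                                      ∙ (if does (v ≟ v′) then g u′ v′ else 0#)))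
              ≈ sum (f u) ∙ sum (λ u′ → g u′ v)
  sum-cross u v f g =
    ≈-trans (sum-cong-≋ (λ u′ → ∑-distrib-+ (λ v′ → if does (u ≟ u′) then f u′ v′ else 0#) _))
    (≈-trans (∑-distrib-+ (λ u′ → sum (λ v′ → if does (u ≟ u′) then f u′ v′ else 0#)) _)
      (∙-cong
        (≈-trans (∑-comm (λ u′ v′ → if does (u ≟ u′) then f u′ v′ else 0#))
                 (sum-cong-≋ (λ v′ → sum-single u (λ u′ → f u′ v′))))
        (sum-cong-≋ (λ u′ → sum-single v (g u′)))))

module ℕS = FinSum ℕ.+-0-commutativeMonoid
module ℤS = FinSum ℤ.+-0-commutativeMonoid

∑≡sum : ∀ {m} (f : Fin m → ℕ) → ∑ f ≡ ℕΣ.sum f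
∑≡sum {zero}  f = refl
∑≡sum {suc m} f = cong (f zero ℕ.+_) (∑≡sum (f ∘ suc))

∑ℤ≡sum : ∀ {m} (f : Fin m → ℤ) → ∑ℤ f ≡ ℤΣ.sum f
∑ℤ≡sum {zero}  f = refl
∑ℤ≡sum {suc m} f = cong (ℤ._+_ (f zero)) (∑ℤ≡sum (f ∘ suc))

pos-sum : ∀ {m} (f : Fin m → ℕ) → + ℕΣ.sum f ≡ ℤΣ.sum (λ i → + f i)
pos-sum {zero}  f = refl
pos-sum {suc m} f = trans (ℤ.pos-+ (f zero) _) (cong (ℤ._+_ (+ f zero)) (pos-sum (f ∘ suc)))

sum-mono : ∀ {m} {f g : Fin m → ℕ} → (∀ i → f i ≤ g i) → ℕΣ.sum f ≤ ℕΣ.sum g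
sum-mono {zero}  f≤g = z≤n
sum-mono {suc m} f≤g = ℕ.+-mono-≤ (f≤g zero) (sum-mono (f≤g ∘ suc))

sum-const : ∀ m c → ℕΣ.sum {m} (λ _ → c) ≡ m * c
sum-const zero    c = refl
sum-const (suc m) c = cong (c ℕ.+_) (sum-const m c)

sum-constℤ : ∀ m c → ℤΣ.sum {m} (λ _ → c) ≡ + m ℤ.* c
sum-constℤ zero    c = sym (ℤ.*-zeroˡ c)
sum-constℤ (suc m) c = trans (cong (ℤ._+_ c) (sum-constℤ m c)) (sym (ℤ.suc-* (+ m) c))

term≤sum : ∀ {m} (f : Fin m → ℕ) i → f i ≤ ℕΣ.sum f
term≤sum f zero    = ℕ.m≤m+n _ _
term≤sum f (suc i) = ℕ.≤-trans (term≤sum (f ∘ suc) i) (ℕ.m≤n+m _ _)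

-- Serves to add the cuts of two different copies of `G` in the egg-cut bound on the product.
terms≤sum : ∀ {m} (f : Fin m → ℕ) {i j} → i ≢ j → f i + f j ≤ ℕΣ.sum f
terms≤sum f {zero}  {zero}  i≢j = contradiction refl i≢j
terms≤sum f {zero}  {suc j} i≢j = ℕ.+-monoʳ-≤ (f zero) (term≤sum (f ∘ suc) j)
terms≤sum f {suc i} {zero}  i≢j =
  ℕ.≤-trans (ℕ.≤-reflexive (ℕ.+-comm (f (suc i)) (f zero)))
            (ℕ.+-monoʳ-≤ (f zero) (term≤sum (f ∘ suc) i))
terms≤sum f {suc i} {suc j} i≢j =
  ℕ.≤-trans (terms≤sum (f ∘ suc) (i≢j ∘ cong suc)) (ℕ.m≤n+m _ _)

sum-monoℤ : ∀ {m} {f g : Fin m → ℤ} → (∀ i → f i ℤ.≤ g i) → ℤΣ.sum f ℤ.≤ ℤΣ.sum g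
sum-monoℤ {zero}  f≤g = ℤ.≤-refl
sum-monoℤ {suc m} f≤g = ℤ.+-mono-≤ (f≤g zero) (sum-monoℤ (f≤g ∘ suc))

-- Subsets through their characteristic functions

⟦_⟧ : Bool → ℕ
⟦ b ⟧ = if b then 1 else 0

∣p∣≡sum : ∀ {m} (p : Subset m) → ∣ p ∣ ≡ ℕΣ.sum (λ i → ⟦ lookup p i ⟧)
∣p∣≡sum Vec.[]            = refl
∣p∣≡sum (inside  Vec.∷ p) = cong suc (∣p∣≡sum p)
∣p∣≡sum (outside Vec.∷ p) = ∣p∣≡sum p

∈-tabulate⁺ : ∀ {m} {f : Fin m → Bool} {i} → f i ≡ true → i ∈ tabulate f
∈-tabulate⁺ {f = f} {i} fi = lookup⇒[]= i _ (trans (lookup∘tabulate f i) fi)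

∈-tabulate⁻ : ∀ {m} {f : Fin m → Bool} {i} → i ∈ tabulate f → f i ≡ true
∈-tabulate⁻ {f = f} {i} i∈ = trans (sym (lookup∘tabulate f i)) ([]=⇒lookup i∈)

-- The Laplacian and chip firing

-- The negative of the usual graph Laplacian: `D + Δ f` is what remains of `D` after each vertex `w`
-- has fired `f w` times.
Δ : (G : Graph) → (Fin (n G) → ℤ) → Fin (n G) → ℤ
Δ G f u = ℤΣ.sum λ w → + adj G u w ℤ.* (f w ℤ.- f u)

module _ (G : Graph) where

  Δ-cong : ∀ {f g} → (∀ u → f u ≡ g u) → ∀ u → Δ G f u ≡ Δ G g u
  Δ-cong f≗g u = ℤΣ.sum-cong-≗ λ w →
    cong₂ (λ x y → + adj G u w ℤ.* (x ℤ.- y)) (f≗g w) (f≗g u)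

  Δ-+ : ∀ f g u → Δ G (λ x → f x ℤ.+ g x) u ≡ Δ G f u ℤ.+ Δ G g u
  Δ-+ f g u = trans
    (ℤΣ.sum-cong-≗ λ w → distrib (+ adj G u w) (f w) (g w) (f u) (g u))
    (ℤΣ.∑-distrib-+ (λ w → + adj G u w ℤ.* (f w ℤ.- f u)) _)
    where
    distrib : ∀ a x y x′ y′ → a ℤ.* ((x ℤ.+ y) ℤ.- (x′ ℤ.+ y′)) ≡ a ℤ.* (x ℤ.- x′) ℤ.+ a ℤ.* (y ℤ.- y′)
    distrib = solve-∀

  Δ-const : ∀ c u → Δ G (λ _ → c) u ≡ 0ℤ
  Δ-const c u = trans (ℤΣ.sum-cong-≗ λ w → cancel (+ adj G u w) c) (ℤΣ.sum-replicate-zero (n G))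
    where
    cancel : ∀ a c → a ℤ.* (c ℤ.- c) ≡ 0ℤ
    cancel = solve-∀

  -- Firing moves chips without creating any. By symmetry of `adj` each summand is `p u w` minus
  -- `p w u`; adding the double sum of `p w u` leaves the double sum of `p u w`, which is the same
  -- number.
  sum-Δ : ∀ f → ℤΣ.sum (Δ G f) ≡ 0ℤ
  sum-Δ f = identityˡ-unique _ (ℤΣ.sum λ u → ℤΣ.sum λ w → p w u) (begin
    ℤΣ.sum (Δ G f) ℤ.+ (ℤΣ.sum λ u → ℤΣ.sum λ w → p w u)
      ≡⟨ ℤΣ.∑-distrib-+ (Δ G f) _ ⟨
    (ℤΣ.sum λ u → Δ G f u ℤ.+ ℤΣ.sum λ w → p w u)
      ≡⟨ (ℤΣ.sum-cong-≗ λ u → sym (ℤΣ.∑-distrib-+ (λ w → + adj G u w ℤ.* (f w ℤ.- f u)) _)) ⟩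
    (ℤΣ.sum λ u → ℤΣ.sum λ w → + adj G u w ℤ.* (f w ℤ.- f u) ℤ.+ p w u)
      ≡⟨ (ℤΣ.sum-cong-≗ λ u → ℤΣ.sum-cong-≗ λ w → flow u w) ⟩
    (ℤΣ.sum λ u → ℤΣ.sum λ w → p u w)
      ≡⟨ ℤΣ.∑-comm p ⟩
    (ℤΣ.sum λ u → ℤΣ.sum λ w → p w u)
      ∎)
    where
    open ≡-Reasoning
    p : Fin (n G) → Fin (n G) → ℤ
    p u w = + adj G u w ℤ.* f w
    ring : ∀ a x y → a ℤ.* (x ℤ.- y) ℤ.+ a ℤ.* y ≡ a ℤ.* x
    ring = solve-∀
    flow : ∀ u w → + adj G u w ℤ.* (f w ℤ.- f u) ℤ.+ p w u ≡ p u w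
    flow u w rewrite adj-sym G w u = ring (+ adj G u w) (f w) (f u)

  δ : Fin (n G) → Fin (n G) → ℤ
  δ w u = + ⟦ does (u ≟ w) ⟧

  Δ-δ-self : ∀ w → Δ G (δ w) w ≡ ℤ.- + val G w
  Δ-δ-self w = begin
    Δ G (δ w) w                                  ≡⟨ ℤΣ.sum-cong-≗ term ⟩
    (ℤΣ.sum λ x → ℤ.-1ℤ ℤ.* + adj G w x)         ≡⟨ ℤΣ.*-distribˡ-sum ℤ.-1ℤ (λ x → + adj G w x) ⟨
    ℤ.-1ℤ ℤ.* (ℤΣ.sum λ x → + adj G w x)         ≡⟨ ℤ.-1*i≡-i _ ⟩
    ℤ.- (ℤΣ.sum λ x → + adj G w x)               ≡⟨ cong ℤ.-_ (pos-sum (adj G w)) ⟨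
    ℤ.- + ℕΣ.sum (adj G w)                       ≡⟨ cong (λ s → ℤ.- + s) (∑≡sum (adj G w)) ⟨
    ℤ.- + val G w                                ∎
    where
    open ≡-Reasoning
    swap : ∀ a → a ℤ.* (0ℤ ℤ.- 1ℤ) ≡ ℤ.-1ℤ ℤ.* a
    swap = solve-∀
    term : ∀ x → + adj G w x ℤ.* (δ w x ℤ.- δ w w) ≡ ℤ.-1ℤ ℤ.* + adj G w x
    term x rewrite dec-true (w ≟ w) refl with x ≟ w
    ... | yes refl rewrite loopless G w = refl
    ... | no  _    = swap (+ adj G w x)

  Δ-δ-other : ∀ {u w} → u ≢ w → Δ G (δ w) u ≡ + adj G u w
  Δ-δ-other {u} {w} u≢w = trans (ℤΣ.sum-cong-≗ term) (ℤS.sum-single w (λ x → + adj G u x))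
    where
    one : ∀ a → a ℤ.* (1ℤ ℤ.- 0ℤ) ≡ a
    one = solve-∀
    zer : ∀ a → a ℤ.* (0ℤ ℤ.- 0ℤ) ≡ 0ℤ
    zer = solve-∀
    term : ∀ x → + adj G u x ℤ.* (δ w x ℤ.- δ w u) ≡ (if does (w ≟ x) then + adj G u x else 0ℤ)
    term x rewrite dec-false (u ≟ w) u≢w | ≟-does-sym w x with does (x ≟ w)
    ... | true  = one (+ adj G u x)
    ... | false = zer (+ adj G u x)

  fire≡Δ : ∀ w D u → fire G w D u ≡ D u ℤ.+ Δ G (δ w) u
  -- Only the test inside `fire` is split; the copies of `u ≟ w` inside `Δ G (δ w) u` stay intact
  -- for the two lemmas on `δ`.
  fire≡Δ w D u = by-cases (u ≟ w)
    where
    by-cases : (d : Dec (u ≡ w)) →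
               (if does d then D u ℤ.- + val G w else D u ℤ.+ + adj G u w) ≡ D u ℤ.+ Δ G (δ w) u
    by-cases (yes refl) = cong (ℤ._+_ (D u)) (sym (Δ-δ-self w))
    by-cases (no  u≢w)  = cong (ℤ._+_ (D u)) (sym (Δ-δ-other u≢w))

  -- The script counts how often each vertex fires along the chain; additivity of `Δ` makes the
  -- order of firings irrelevant.
  Equivalent⇒Δ : ∀ {D E} → Equivalent G D E → ∃ λ f → ∀ u → E u ≡ D u ℤ.+ Δ G f u
  Equivalent⇒Δ {D} ε = (λ _ → 0ℤ) , λ u →
    sym (trans (cong (ℤ._+_ (D u)) (Δ-const 0ℤ u)) (ℤ.+-identityʳ (D u)))
  Equivalent⇒Δ {D} {E} ((w , refl) ◅ eqv) = let f , E≡ = Equivalent⇒Δ eqv in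
    (λ u → δ w u ℤ.+ f u) , λ u → begin
      E u                                        ≡⟨ E≡ u ⟩
      fire G w D u ℤ.+ Δ G f u                   ≡⟨ cong (ℤ._+ Δ G f u) (fire≡Δ w D u) ⟩
      (D u ℤ.+ Δ G (δ w) u) ℤ.+ Δ G f u          ≡⟨ ℤ.+-assoc (D u) _ _ ⟩
      D u ℤ.+ (Δ G (δ w) u ℤ.+ Δ G f u)          ≡⟨ cong (ℤ._+_ (D u)) (Δ-+ (δ w) f u) ⟨
      D u ℤ.+ Δ G (λ x → δ w x ℤ.+ f x) u        ∎
    where open ≡-Reasoning

  -- `FireStep` compares divisors by `≡` of functions, while scripts determine them only pointwise.
  -- Hence the divisor reached is given existentially and its formula vertex by vertex.
  record Realizable (f : Fin (n G) → ℤ) : Set where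
    constructor realizes
    field realize : ∀ D → ∃ λ E → Equivalent G D E × (∀ u → E u ≡ D u ℤ.+ Δ G f u)
  open Realizable

  realizable-≗ : ∀ {f g} → (∀ u → f u ≡ g u) → Realizable f → Realizable g
  realizable-≗ f≗g real = realizes λ D → let E , eqv , E≡ = realize real D in
    E , eqv , λ u → trans (E≡ u) (cong (ℤ._+_ (D u)) (Δ-cong f≗g u))

  realizable-const : ∀ c → Realizable (λ _ → c)
  realizable-const c = realizes λ D → D , ε , λ u →
    sym (trans (cong (ℤ._+_ (D u)) (Δ-const c u)) (ℤ.+-identityʳ (D u)))

  realizable-+ : ∀ {f g} → Realizable f → Realizable g → Realizable (λ u → f u ℤ.+ g u)
  realizable-+ {f} {g} real-f real-g = realizes λ D →
    let E , D~E , E≡ = realize real-f D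
        F , E~F , F≡ = realize real-g E
    in F , D~E ◅◅ E~F , λ u → begin
      F u                              ≡⟨ F≡ u ⟩
      E u ℤ.+ Δ G g u                  ≡⟨ cong (ℤ._+ Δ G g u) (E≡ u) ⟩
      (D u ℤ.+ Δ G f u) ℤ.+ Δ G g u    ≡⟨ ℤ.+-assoc (D u) _ _ ⟩
      D u ℤ.+ (Δ G f u ℤ.+ Δ G g u)    ≡⟨ cong (ℤ._+_ (D u)) (Δ-+ f g u) ⟨
      D u ℤ.+ Δ G (λ x → f x ℤ.+ g x) u ∎
    where open ≡-Reasoning

  realizable-sum : ∀ {k} {h : Fin k → Fin (n G) → ℤ} → (∀ i → Realizable (h i)) →
                   Realizable (λ u → ℤΣ.sum (λ i → h i u))
  realizable-sum {zero}  real = realizable-const 0ℤ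
  realizable-sum {suc k} real = realizable-+ (real zero) (realizable-sum (real ∘ suc))

  realizable-* : ∀ {f} k → Realizable f → Realizable (λ u → + k ℤ.* f u)
  realizable-* {f} zero    real = realizable-≗ (λ u → sym (ℤ.*-zeroˡ (f u))) (realizable-const 0ℤ)
  realizable-* {f} (suc k) real =
    realizable-≗ (λ u → sym (ℤ.suc-* (+ k) (f u))) (realizable-+ real (realizable-* k real))

  realizable-δ : ∀ w → Realizable (δ w)
  realizable-δ w = realizes λ D → fire G w D , (w , refl) ◅ ε , fire≡Δ w D

  -- A natural-number script is the sum over `w` of `g w` copies of the indicator of `w`, that is,
  -- `g w` firings of each `w`.
  realizable-pos : (g : Fin (n G) → ℕ) → Realizable (λ u → + g u)
  realizable-pos g = realizable-≗ expand (realizable-sum λ w → realizable-* (g w) (realizable-δ w))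
    where
    term : ∀ u w → + g w ℤ.* δ w u ≡ (if does (u ≟ w) then + g w else 0ℤ)
    term u w with does (u ≟ w)
    ... | true  = ℤ.*-identityʳ (+ g w)
    ... | false = ℤ.*-zeroʳ (+ g w)
    expand : ∀ u → ℤΣ.sum (λ w → + g w ℤ.* δ w u) ≡ + g u
    expand u = trans (ℤΣ.sum-cong-≗ (term u)) (ℤS.sum-single u (λ w → + g w))

  -- Firings cannot be undone directly, but constants lie in the kernel of `Δ`, so a script may be
  -- shifted up until no value is negative. The level-set descent also relies on natural-number
  -- scripts.
  nonneg-script : ∀ f → ∃ λ (g : Fin (n G) → ℕ) → ∀ u → Δ G f u ≡ Δ G (λ x → + g x) u
  nonneg-script f = g , λ u → begin
      Δ G f u                                ≡⟨ ℤ.+-identityʳ _ ⟨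
      Δ G f u ℤ.+ 0ℤ                         ≡⟨ cong (ℤ._+_ (Δ G f u)) (Δ-const (+ c) u) ⟨
      Δ G f u ℤ.+ Δ G (λ _ → + c) u          ≡⟨ Δ-+ f (λ _ → + c) u ⟨
      Δ G (λ x → f x ℤ.+ + c) u              ≡⟨ Δ-cong (λ x → sym (ℤ.0≤i⇒+∣i∣≡i (nonneg x))) u ⟩
      Δ G (λ x → + g x) u                    ∎
    where
    open ≡-Reasoning
    -- Any common upper bound of the absolute values would do; their sum is one.
    c : ℕ
    c = ℕΣ.sum λ u → ℤ.∣ f u ∣
    g : Fin (n G) → ℕ
    g u = ℤ.∣ f u ℤ.+ + c ∣
    0≤i+∣i∣ : ∀ i → 0ℤ ℤ.≤ i ℤ.+ + ℤ.∣ i ∣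
    0≤i+∣i∣ (+ _)        = ℤ.+≤+ z≤n
    0≤i+∣i∣ i@(ℤ.-[1+ _ ]) = ℤ.≤-reflexive (sym (ℤ.+-inverseˡ (ℤ.- i)))
    nonneg : ∀ u → 0ℤ ℤ.≤ f u ℤ.+ + c
    nonneg u = ℤ.≤-trans (0≤i+∣i∣ (f u))
      (ℤ.+-monoʳ-≤ (f u) (ℤ.+≤+ (term≤sum (λ x → ℤ.∣ f x ∣) u)))

  realizable : ∀ f → Realizable f
  realizable f = realizes λ D →
    let g , f≗g = nonneg-script f
        E , eqv , E≡ = realize (realizable-pos g) D
    in E , eqv , λ u → trans (E≡ u) (cong (ℤ._+_ (D u)) (sym (f≗g u)))

-- Scramble order and degree

-- The summand of `cut`. Summed over `v` it is the number of chips `u` sends out of `A` when all of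
-- `A` fires, and 0 for `u` outside `A`.
∂ : (G : Graph) → Subset (n G) → Fin (n G) → Fin (n G) → ℕ
∂ G A u v = if lookup A u ∧ not (lookup A v) then adj G u v else 0

cut≡sum : ∀ G A → cut G A ≡ ℕΣ.sum λ u → ℕΣ.sum (∂ G A u)
cut≡sum G A = trans (∑≡sum λ u → ∑ (∂ G A u)) (ℕΣ.sum-cong-≗ λ u → ∑≡sum (∂ G A u))

does-true⇒ : ∀ {A : Set} (a? : Dec A) → does a? ≡ true → A
does-true⇒ (yes a) _ = a

does-false⇒ : ∀ {A : Set} (a? : Dec A) → does a? ≡ false → ¬ A
does-false⇒ (no ¬a) _ = ¬a

inside⊎outside : ∀ {m} (p : Subset m) i → i ∈ p ⊎ lookup p i ≡ false
inside⊎outside p i with lookup p i in eq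
... | true  = inj₁ (lookup⇒[]= i p eq)
... | false = inj₂ refl

false⇒∈∁ : ∀ {m} {p : Subset m} {i} → lookup p i ≡ false → i ∈ ∁ p
false⇒∈∁ {p = p} {i} eq = x∉p⇒x∈∁p λ i∈p → contradiction (trans (sym ([]=⇒lookup i∈p)) eq) λ ()

i≤i+pos : ∀ i k → i ℤ.≤ i ℤ.+ + k
i≤i+pos i k = ℤ.i≤i+j i (+ k)

module _ (G : Graph) where

  χ : Subset (n G) → Fin (n G) → ℤ
  χ U u = + ⟦ lookup U u ⟧

  -- No neighbour of `u` fires more often than `u` itself, so no edge brings `u` a net gain.
  Δ-max≤0 : ∀ (f : Fin (n G) → ℕ) u → (∀ w → f w ≤ f u) → Δ G (λ x → + f x) u ℤ.≤ 0ℤ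
  Δ-max≤0 f u max = ℤ.≤-trans (sum-monoℤ term) (ℤ.≤-reflexive (ℤΣ.sum-replicate-zero (n G)))
    where
    term : ∀ w → + adj G u w ℤ.* (+ f w ℤ.- + f u) ℤ.≤ 0ℤ
    term w = ℤ.≤-trans
      (ℤ.*-monoˡ-≤-nonNeg (+ adj G u w) (ℤ.i≤j⇒i-j≤0 (ℤ.+≤+ (max w))))
      (ℤ.≤-reflexive (ℤ.*-zeroʳ (+ adj G u w)))

  Δ-χ-inside : ∀ U {u} → lookup U u ≡ true → Δ G (χ U) u ≡ ℤ.- + ℕΣ.sum (∂ G U u)
  Δ-χ-inside U {u} u∈U = begin
    Δ G (χ U) u                              ≡⟨ ℤΣ.sum-cong-≗ term ⟩
    (ℤΣ.sum λ w → ℤ.-1ℤ ℤ.* + ∂ G U u w)     ≡⟨ ℤΣ.*-distribˡ-sum ℤ.-1ℤ (λ w → + ∂ G U u w) ⟨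
    ℤ.-1ℤ ℤ.* (ℤΣ.sum λ w → + ∂ G U u w)     ≡⟨ ℤ.-1*i≡-i _ ⟩
    ℤ.- (ℤΣ.sum λ w → + ∂ G U u w)           ≡⟨ cong ℤ.-_ (pos-sum (∂ G U u)) ⟨
    ℤ.- + ℕΣ.sum (∂ G U u)                   ∎
    where
    open ≡-Reasoning
    minus : ∀ a → a ℤ.* (0ℤ ℤ.- 1ℤ) ≡ ℤ.-1ℤ ℤ.* a
    minus = solve-∀
    term : ∀ w → + adj G u w ℤ.* (χ U w ℤ.- χ U u) ≡ ℤ.-1ℤ ℤ.* + ∂ G U u w
    term w rewrite u∈U with lookup U w
    ... | true  = ℤ.*-zeroʳ (+ adj G u w)
    ... | false = minus (+ adj G u w)

  inflow : Subset (n G) → Fin (n G) → Fin (n G) → ℕ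
  inflow U u w = if lookup U w then adj G u w else 0

  Δ-χ-outside : ∀ U {u} → lookup U u ≡ false → Δ G (χ U) u ≡ + ℕΣ.sum (inflow U u)
  Δ-χ-outside U {u} u∉U = trans (ℤΣ.sum-cong-≗ term) (sym (pos-sum (inflow U u)))
    where
    term : ∀ w → + adj G u w ℤ.* (χ U w ℤ.- χ U u) ≡ + inflow U u w
    term w rewrite u∉U with lookup U w
    ... | true  = ℤ.*-identityʳ (+ adj G u w)
    ... | false = ℤ.*-zeroʳ (+ adj G u w)

  reach-source : ∀ {S x y} → Reach G S x y → x ∈ S
  reach-source (here x∈S)     = x∈S
  reach-source (step x∈S _ _) = x∈S

  -- Follow the path to its first edge leaving `U`. Its ends lie in `S` because all vertices of the
  -- path do.
  reach-crossing : ∀ {S x y} U → Reach G S x y → lookup U x ≡ true → lookup U y ≡ false →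
    ∃ λ a → ∃ λ b → a ∈ S × b ∈ S × lookup U a ≡ true × lookup U b ≡ false × 0 < adj G a b
  reach-crossing U (here _) x∈U x∉U = contradiction (trans (sym x∈U) x∉U) λ ()
  reach-crossing U (step {w = w} x∈S e r) x∈U y∉U with lookup U w in eq
  ... | true  = reach-crossing U r eq y∉U
  ... | false = _ , _ , x∈S , reach-source r , x∈U , eq , e

  HitBy : Divisor G → Subset (n G) → Set
  HitBy D E = ∃ λ v → v ∈ E × 0ℤ ℤ.< D v

  hitBy? : ∀ D E → Dec (HitBy D E)
  hitBy? D E = any? λ v → (v ∈? E) ×-dec (0ℤ ℤ.<? D v)

  module SetFiring {D : Divisor G} (D≥0 : Effective G D) (U : Subset (n G))
                   (D′≥0 : Effective G (λ u → D u ℤ.+ Δ G (χ U) u)) where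

    D′ : Divisor G
    D′ u = D u ℤ.+ Δ G (χ U) u

    outside-gains : ∀ {u} → lookup U u ≡ false → D u ℤ.≤ D′ u
    outside-gains {u} u∉U rewrite Δ-χ-outside U u∉U = i≤i+pos (D u) _

    neighbour-hit : ∀ {a b} → lookup U a ≡ true → lookup U b ≡ false → 0 < adj G a b → 0ℤ ℤ.< D′ b
    neighbour-hit {a} {b} a∈U b∉U e rewrite Δ-χ-outside U b∉U =
      ℤ.+-mono-≤-< (D≥0 b) (ℤ.+<+ (ℕ.<-≤-trans 0<inflow (term≤sum (inflow U b) a)))
      where
      0<inflow : 0 < inflow U b a
      0<inflow rewrite a∈U | adj-sym G b a = e

    -- A vertex of `U` loses exactly its outflow and is still not in debt afterwards; a vertex
    -- outside `U` has outflow 0.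
    outflow≤ : ∀ u → + ℕΣ.sum (∂ G U u) ℤ.≤ D u
    outflow≤ u with lookup U u in eq
    ... | true  = ℤ.0≤i-j⇒j≤i (subst (λ x → 0ℤ ℤ.≤ D u ℤ.+ x) lem (D′≥0 u))
      where
      -- The case split has turned `lookup U u` into `true` in the goal, so the outflow is restated
      -- with that literal.
      lem : Δ G (χ U) u ≡ ℤ.- + ℕΣ.sum (λ v → if true ∧ not (lookup U v) then adj G u v else 0)
      lem = trans (Δ-χ-inside U eq) (cong (λ b → ℤ.- + ℕΣ.sum (λ v → if b ∧ not (lookup U v) then adj G u v else 0)) eq)
    ... | false = subst (λ s → + s ℤ.≤ D u) (sym (ℕΣ.sum-replicate-zero (n G))) (D≥0 u)

    source-hit : ∀ {a b} → lookup U a ≡ true → lookup U b ≡ false → 0 < adj G a b → 0ℤ ℤ.< D a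
    source-hit {a} {b} a∈U b∉U e =
      ℤ.<-≤-trans (ℤ.+<+ (ℕ.<-≤-trans 0<∂ (term≤sum (∂ G U a) b))) (outflow≤ a)
      where
      0<∂ : 0 < ∂ G U a b
      0<∂ rewrite a∈U | b∉U = e

    cut≤deg : + cut G U ℤ.≤ ℤΣ.sum D
    cut≤deg = ℤ.≤-trans
      (ℤ.≤-reflexive (trans (cong +_ (cut≡sum G U)) (pos-sum (λ u → ℕΣ.sum (∂ G U u)))))
      (sum-monoℤ outflow≤)

    -- Vertices outside `U` lose nothing, so the chip that hit the egg was in `U`. If the connected
    -- egg left `U`, an edge inside it would carry a chip to its outer end, and the egg would still
    -- be hit.
    lost-egg⊆ : ∀ {E} → InducesConnected G E → HitBy D E → ¬ HitBy D′ E → ∀ y → y ∈ E → y ∈ U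
    lost-egg⊆ {E} (_ , conn) (x , x∈E , 0<Dx) ¬hit y y∈E with inside⊎outside U y
    ... | inj₁ y∈U = y∈U
    ... | inj₂ y∉U with inside⊎outside U x
    ...   | inj₂ x∉U = contradiction (x , x∈E , ℤ.<-≤-trans 0<Dx (outside-gains x∉U)) ¬hit
    ...   | inj₁ x∈U with reach-crossing U (conn x y x∈E y∈E) ([]=⇒lookup x∈U) y∉U
    ...     | a , b , _ , b∈E , a∈U , b∉U , e = contradiction (b , b∈E , neighbour-hit a∈U b∉U e) ¬hit

    -- If the egg also met `U`, an edge inside it would leave `U`, and its inner end would need a
    -- chip of `D` to pay for that edge.
    unhit-egg⊆∁ : ∀ {E v} → InducesConnected G E → ¬ HitBy D E → v ∈ E → lookup U v ≡ false →
                  ∀ y → y ∈ E → y ∈ ∁ U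
    unhit-egg⊆∁ {v = v} (_ , conn) ¬hit v∈E v∉U y y∈E with inside⊎outside U y
    ... | inj₂ y∉U = false⇒∈∁ y∉U
    ... | inj₁ y∈U with reach-crossing U (conn y v y∈E v∈E) ([]=⇒lookup y∈U) v∉U
    ...   | a , b , a∈E , _ , a∈U , b∉U , e = contradiction (a , a∈E , source-hit a∈U b∉U e) ¬hit

  -- Linear equivalence through scripts

  infix 4 _∼_
  -- Scripts may take negative values, so symmetry is a change of sign, and the comparison is
  -- pointwise, unlike that of `Equivalent`.
  record _∼_ (D D′ : Divisor G) : Set where
    constructor script
    field
      {f} : Fin (n G) → ℤ
      eq  : ∀ u → D′ u ≡ D u ℤ.+ Δ G f u

  ∼-trans : ∀ {D E F} → D ∼ E → E ∼ F → D ∼ F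
  ∼-trans {D} {E} {F} (script {f} E≡) (script {g} F≡) = script {f = λ u → f u ℤ.+ g u} λ u → begin
    F u                                ≡⟨ F≡ u ⟩
    E u ℤ.+ Δ G g u                    ≡⟨ cong (ℤ._+ Δ G g u) (E≡ u) ⟩
    (D u ℤ.+ Δ G f u) ℤ.+ Δ G g u      ≡⟨ ℤ.+-assoc (D u) _ _ ⟩
    D u ℤ.+ (Δ G f u ℤ.+ Δ G g u)      ≡⟨ cong (ℤ._+_ (D u)) (Δ-+ G f g u) ⟨
    D u ℤ.+ Δ G (λ x → f x ℤ.+ g x) u  ∎
    where open ≡-Reasoning

  ∼-sym : ∀ {D E} → D ∼ E → E ∼ D
  ∼-sym {D} {E} (script {f} E≡) = script {f = λ u → ℤ.- f u} λ u → begin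
    D u                                                ≡⟨ ℤ.+-identityʳ _ ⟨
    D u ℤ.+ 0ℤ                                         ≡⟨ cong (ℤ._+_ (D u)) (Δ-const G 0ℤ u) ⟨
    D u ℤ.+ Δ G (λ _ → 0ℤ) u                           ≡⟨ cong (ℤ._+_ (D u)) (Δ-cong G (λ x → sym (ℤ.+-inverseʳ (f x))) u) ⟩
    D u ℤ.+ Δ G (λ x → f x ℤ.- f x) u                  ≡⟨ cong (ℤ._+_ (D u)) (Δ-+ G f (λ x → ℤ.- f x) u) ⟩
    D u ℤ.+ (Δ G f u ℤ.+ Δ G (λ x → ℤ.- f x) u)        ≡⟨ ℤ.+-assoc (D u) _ _ ⟨
    (D u ℤ.+ Δ G f u) ℤ.+ Δ G (λ x → ℤ.- f x) u        ≡⟨ cong (ℤ._+ Δ G (λ x → ℤ.- f x) u) (E≡ u) ⟨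
    E u ℤ.+ Δ G (λ x → ℤ.- f x) u                      ∎
    where open ≡-Reasoning

  deg-∼ : ∀ {D D′} → D ∼ D′ → ℤΣ.sum D′ ≡ ℤΣ.sum D
  deg-∼ {D} {D′} (script {f} D′≡) = begin
    ℤΣ.sum D′                                ≡⟨ ℤΣ.sum-cong-≗ D′≡ ⟩
    (ℤΣ.sum λ u → D u ℤ.+ Δ G f u)           ≡⟨ ℤΣ.∑-distrib-+ D (Δ G f) ⟩
    ℤΣ.sum D ℤ.+ ℤΣ.sum (Δ G f)              ≡⟨ cong (ℤ._+_ (ℤΣ.sum D)) (sum-Δ G f) ⟩
    ℤΣ.sum D ℤ.+ 0ℤ                          ≡⟨ ℤ.+-identityʳ _ ⟩
    ℤΣ.sum D                                 ∎
    where open ≡-Reasoning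

  support : Divisor G → Subset (n G)
  support D = tabulate λ v → does (0ℤ ℤ.<? D v)

  ∣support∣≤deg : ∀ {D} → Effective G D → + ∣ support D ∣ ℤ.≤ ℤΣ.sum D
  ∣support∣≤deg {D} D≥0 = ℤ.≤-trans
    (ℤ.≤-reflexive (trans (cong +_ (∣p∣≡sum (support D))) (pos-sum (λ i → ⟦ lookup (support D) i ⟧))))
    (sum-monoℤ term)
    where
    term : ∀ v → + ⟦ lookup (support D) v ⟧ ℤ.≤ D v
    term v rewrite lookup∘tabulate (λ v → does (0ℤ ℤ.<? D v)) v with 0ℤ ℤ.<? D v
    ... | yes 0<Dv = ℤ.i<j⇒suc[i]≤j 0<Dv
    ... | no  _    = D≥0 v

  -- The chip taken away at `v` is put back on the effective representative of `D - (v)`; the script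
  -- stays the same.
  positiveRank⇒∼ : ∀ {D} → PositiveRank G D → ∀ v → ∃ λ F → Effective G F × 0ℤ ℤ.< F v × D ∼ F
  positiveRank⇒∼ {D} rank v =
    let E , E≥0 , eqv = rank v
        f , E≡ = Equivalent⇒Δ G eqv
    in (λ u → E u ℤ.+ δ G v u)
       , (λ u → ℤ.≤-trans (E≥0 u) (i≤i+pos (E u) _))
       , 0<Ev+1 (E≥0 v)
       , script {f = f} λ u → trans (cong (ℤ._+ δ G v u) (E≡ u)) (restore u (Δ G f u))
    where
    0<Ev+1 : ∀ {e} → 0ℤ ℤ.≤ e → 0ℤ ℤ.< e ℤ.+ δ G v v
    0<Ev+1 0≤e rewrite dec-true (v ≟ v) refl = ℤ.+-mono-≤-< 0≤e (ℤ.+<+ (s≤s z≤n))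
    ring₁ : ∀ d s → ((d ℤ.- 1ℤ) ℤ.+ s) ℤ.+ 1ℤ ≡ d ℤ.+ s
    ring₁ = solve-∀
    restore : ∀ u s → (minusPoint G D v u ℤ.+ s) ℤ.+ δ G v u ≡ D u ℤ.+ s
    restore u s with does (u ≟ v)
    ... | true  = ring₁ (D u) s
    ... | false = ℤ.+-identityʳ _

  -- Only lower bounds on hitting sets and egg cuts enter. A scramble whose eggs cannot be separated
  -- is thereby included, with `cuts≥` vacuous.
  module ScrambleBound (S : Scramble G) (eggs : IsScramble G S) {m : ℕ}
                       (hits≥ : ∀ C → Hits G S C → m ≤ ∣ C ∣)
                       (cuts≥ : ∀ A → Separates G S A → m ≤ cut G A) where

    connected : ∀ {E} → E List.∈ S → InducesConnected G E
    connected = All.lookup eggs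

    Progress : Divisor G → Subset (n G) → Set
    Progress D E = ∃ λ D′ → Effective G D′ × D ∼ D′
      × (∀ {E′} → E′ List.∈ S → HitBy D E′ → HitBy D′ E′) × HitBy D′ E

    -- Firing the level set where the script is maximal keeps the divisor effective and lowers
    -- the maximum.  An egg that loses all its chips in this way lies inside the level set, while
    -- the egg E lies outside it, so the level set is an egg cut.
    descend : ∀ M (f : Fin (n G) → ℕ) → (∀ u → f u ≤ M) → ∀ {D F} → Effective G D → Effective G F →
              (∀ u → F u ≡ D u ℤ.+ Δ G (λ x → + f x) u) →
              ∀ {E v} → E List.∈ S → ¬ HitBy D E → v ∈ E → 0ℤ ℤ.< F v →
              + m ℤ.≤ ℤΣ.sum D ⊎ Progress D E
    -- The script is now constantly 0, so `D` and `F` agree and `v` already carries a chip of `D`.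
    descend zero f f≤0 {D} {F} D≥0 F≥0 F≡ {v = v} E∈S ¬hit v∈E 0<Fv = contradiction (v , v∈E , 0<Dv) ¬hit
      where
      0<Dv : 0ℤ ℤ.< D v
      0<Dv = subst (0ℤ ℤ.<_) (trans (F≡ v) (trans
        (cong (ℤ._+_ (D v)) (trans (Δ-cong G (λ x → cong +_ (ℕ.n≤0⇒n≡0 (f≤0 x))) v) (Δ-const G 0ℤ v)))
        (ℤ.+-identityʳ (D v)))) 0<Fv
    descend (suc M) f f≤ {D} {F} D≥0 F≥0 F≡ {E} {v} E∈S ¬hit v∈E 0<Fv = result
      where
      -- `M` is only an upper bound, so this level set may be empty; then the divisor is unchanged
      -- and only the bound drops.
      U : Subset (n G)
      U = tabulate λ u → does (f u ℕ.≟ suc M)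

      f′ : Fin (n G) → ℕ
      f′ u = f u ∸ ⟦ lookup U u ⟧

      U≡ : ∀ u → does (f u ℕ.≟ suc M) ≡ lookup U u
      U≡ u = sym (lookup∘tabulate (λ u → does (f u ℕ.≟ suc M)) u)

      inU : ∀ {u} → lookup U u ≡ true → f u ≡ suc M
      inU {u} eq = does-true⇒ (f u ℕ.≟ suc M) (trans (U≡ u) eq)

      notInU : ∀ {u} → lookup U u ≡ false → f u ≢ suc M
      notInU {u} eq = does-false⇒ (f u ℕ.≟ suc M) (trans (U≡ u) eq)

      f′≤ : ∀ u → f′ u ≤ M
      f′≤ u with lookup U u in eq
      ... | true  = ℕ.∸-monoˡ-≤ 1 (f≤ u)
      ... | false = ℕ.≤-pred (ℕ.≤∧≢⇒< (f≤ u) (notInU eq))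

      f≡ : ∀ u → + f u ≡ χ U u ℤ.+ + f′ u
      f≡ u with lookup U u in eq
      ... | true  rewrite inU eq = refl
      ... | false = refl

      D′ : Divisor G
      D′ u = D u ℤ.+ Δ G (χ U) u

      F≡′ : ∀ u → F u ≡ D′ u ℤ.+ Δ G (λ x → + f′ x) u
      F≡′ u = begin
        F u                                                    ≡⟨ F≡ u ⟩
        D u ℤ.+ Δ G (λ x → + f x) u                            ≡⟨ cong (ℤ._+_ (D u)) (Δ-cong G f≡ u) ⟩
        D u ℤ.+ Δ G (λ x → χ U x ℤ.+ + f′ x) u                 ≡⟨ cong (ℤ._+_ (D u)) (Δ-+ G (χ U) (λ x → + f′ x) u) ⟩
        D u ℤ.+ (Δ G (χ U) u ℤ.+ Δ G (λ x → + f′ x) u)         ≡⟨ ℤ.+-assoc (D u) _ _ ⟨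
        D′ u ℤ.+ Δ G (λ x → + f′ x) u                          ∎
        where open ≡-Reasoning

      D′≥0 : Effective G D′
      D′≥0 u with inside⊎outside U u
      ... | inj₂ u∉U rewrite Δ-χ-outside U u∉U = ℤ.≤-trans (D≥0 u) (i≤i+pos (D u) _)
      -- On `U` the remaining script `f′` takes its maximal value `M`, so the rest of the way to `F`
      -- brings `u` no chips and `D′ u` is at least `F u`.
      ... | inj₁ u∈U = ℤ.≤-trans (F≥0 u) (ℤ.≤-trans
              (ℤ.≤-reflexive (F≡′ u))
              (ℤ.≤-trans (ℤ.+-monoʳ-≤ (D′ u) (Δ-max≤0 f′ u f′-max)) (ℤ.≤-reflexive (ℤ.+-identityʳ (D′ u)))))
        where
        f′-max : ∀ w → f′ w ≤ f′ u
        f′-max w rewrite []=⇒lookup u∈U | inU ([]=⇒lookup u∈U) = f′≤ w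

      -- Were `f` maximal at `v`, the whole script would bring `v` no chips, and the chip of `F` at
      -- `v` would already be in `D`.
      v∉U : lookup U v ≡ false
      v∉U with inside⊎outside U v
      ... | inj₂ v∉U = v∉U
      ... | inj₁ v∈U = contradiction (v , v∈E , ℤ.<-≤-trans 0<Fv Fv≤Dv) ¬hit
        where
        f-max : ∀ w → f w ≤ f v
        f-max w rewrite inU ([]=⇒lookup v∈U) = f≤ w
        Fv≤Dv : F v ℤ.≤ D v
        Fv≤Dv = ℤ.≤-trans (ℤ.≤-reflexive (F≡ v)) (ℤ.≤-trans
          (ℤ.+-monoʳ-≤ (D v) (Δ-max≤0 f v f-max)) (ℤ.≤-reflexive (ℤ.+-identityʳ (D v))))

      open SetFiring D≥0 U D′≥0 using (cut≤deg; lost-egg⊆; unhit-egg⊆∁)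

      D∼D′ : D ∼ D′
      D∼D′ = script {f = χ U} λ u → refl

      result : + m ℤ.≤ ℤΣ.sum D ⊎ Progress D E
      result with All.all? (λ E′ → hitBy? D E′ →-dec hitBy? D′ E′) S
      ... | no ¬keep = inj₁ (ℤ.≤-trans (ℤ.+≤+ (cuts≥ U (lost , kept))) cut≤deg)
        where
        lost : ContainsEgg G S U
        lost with List.find (All.¬All⇒Any¬ (λ E′ → hitBy? D E′ →-dec hitBy? D′ E′) S ¬keep)
        ... | E′ , E′∈S , ¬imp = List.lose E′∈S (lost-egg⊆ (connected E′∈S)
                (decidable-stable (hitBy? D E′) λ ¬h → ¬imp λ h → contradiction h ¬h)
                (λ h → ¬imp λ _ → h))
        kept : ContainsEgg G S (∁ U)
        kept = List.lose E∈S (unhit-egg⊆∁ (connected E∈S) ¬hit v∈E v∉U)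
      ... | yes keep with hitBy? D′ E
      ...   | yes hit′ = inj₂ (D′ , D′≥0 , D∼D′ , All.lookup keep , hit′)
      ...   | no ¬hit′ with descend M f′ f′≤ D′≥0 F≥0 F≡′ E∈S ¬hit′ v∈E 0<Fv
      ...     | inj₁ m≤ = inj₁ (subst (+ m ℤ.≤_) (deg-∼ D∼D′) m≤)
      ...     | inj₂ (D″ , D″≥0 , D′∼D″ , keep′ , hit″) =
                inj₂ (D″ , D″≥0 , ∼-trans D∼D′ D′∼D″
                     , (λ E′∈S h → keep′ E′∈S (All.lookup keep E′∈S h)) , hit″)

    -- T lists all eggs that D does not hit; it shrinks whenever an egg gets hit without another one being lost.
    bound : ∀ {D₀} → PositiveRank G D₀ → ∀ k (T : List (Subset (n G))) → length T ≤ k →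
            ∀ D → Effective G D → D₀ ∼ D →
            (∀ {E} → E List.∈ S → ¬ HitBy D E → E List.∈ T) → + m ℤ.≤ ℤΣ.sum D
    bound rank k T ∣T∣≤k D D≥0 D₀∼D unhit∈T with Any.any? (λ E → ¬? (hitBy? D E)) S
    ... | no all-hit = ℤ.≤-trans (ℤ.+≤+ (hits≥ (support D) (All.tabulate hit))) (∣support∣≤deg D≥0)
      where
      hit : ∀ {E} → E List.∈ S → ∃ λ v → v ∈ E × v ∈ support D
      hit {E} E∈S with hitBy? D E
      ... | yes (v , v∈E , 0<Dv) = v , v∈E , ∈-tabulate⁺ (dec-true (0ℤ ℤ.<? D v) 0<Dv)
      ... | no ¬hit = contradiction (List.lose E∈S ¬hit) all-hit
    ... | yes some with List.find some
    ...   | E , E∈S , ¬hit with proj₁ (connected E∈S)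
    ...     | v , v∈E with positiveRank⇒∼ rank v
    ...       | F , F≥0 , 0<Fv , D₀∼F with ∼-trans (∼-sym D₀∼D) D₀∼F
    ...         | script {g} F≡ with nonneg-script G g
    ...           | f , g≗f with descend (ℕΣ.sum f) f (term≤sum f) D≥0 F≥0
                                   (λ u → trans (F≡ u) (cong (ℤ._+_ (D u)) (g≗f u))) E∈S ¬hit v∈E 0<Fv
    ...             | inj₁ m≤ = m≤
    ...             | inj₂ (D′ , D′≥0 , D∼D′ , keep , hit′) = continue k ∣T∣≤k
      where
      T′ : List (Subset (n G))
      T′ = filter (λ E → ¬? (hitBy? D′ E)) T
      shorter : length T′ < length T
      shorter = filter-notAll (λ E → ¬? (hitBy? D′ E)) T (List.lose (unhit∈T E∈S ¬hit) λ ¬h → ¬h hit′)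
      continue : ∀ k → length T ≤ k → + m ℤ.≤ ℤΣ.sum D
      continue zero    ∣T∣≤0 = contradiction (ℕ.<-≤-trans shorter ∣T∣≤0) ℕ.n≮0
      continue (suc k) ∣T∣≤k = subst (+ m ℤ.≤_) (deg-∼ D∼D′)
        (bound rank k T′ (ℕ.≤-pred (ℕ.<-≤-trans shorter ∣T∣≤k)) D′ D′≥0 (∼-trans D₀∼D D∼D′)
          λ E∈S ¬h → List.∈-filter⁺ (λ E → ¬? (hitBy? D′ E)) (unhit∈T E∈S λ h → ¬h (keep E∈S h)) ¬h)

    m≤deg : ∀ {D} → PositiveRank G D → Fin (n G) → + m ℤ.≤ ℤΣ.sum D
    -- The vertex `v` yields an effective divisor equivalent to `D` to start from; the list of
    -- possibly unhit eggs starts as all of `S`.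
    m≤deg rank v = let F , F≥0 , _ , D∼F = positiveRank⇒∼ rank v in
      subst (+ m ℤ.≤_) (deg-∼ D∼F) (bound rank (length S) S ℕ.≤-refl F F≥0 D∼F λ E∈S _ → E∈S)

-- Existence of the order of a scramble

-- Pass to a set of smaller `μ` as long as there is one; `k` bounds the current value and drops each
-- time.
minimal-subset : ∀ {m} {P : Subset m → Set} → (∀ A → Dec (P A)) → (μ : Subset m → ℕ) →
                 (∀ A → ¬ P A) ⊎ ∃ λ A → P A × (∀ B → P B → μ A ≤ μ B)
minimal-subset {m} {P} P? μ with anySubset? P?
... | no ¬∃        = inj₁ λ A pA → ¬∃ (A , pA)
... | yes (A , pA) = inj₂ (improve (μ A) A pA ℕ.≤-refl)
  where
  improve : ∀ k A → P A → μ A ≤ k → ∃ λ A → P A × (∀ B → P B → μ A ≤ μ B)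
  improve k A pA μA≤k with anySubset? (λ B → P? B ×-dec (μ B ℕ.<? μ A))
  ... | no ¬∃ = A , pA , λ B pB → ℕ.≮⇒≥ λ μB<μA → ¬∃ (B , pB , μB<μA)
  improve zero    A pA μA≤0 | yes (B , pB , μB<μA) = contradiction (ℕ.<-≤-trans μB<μA μA≤0) ℕ.n≮0
  improve (suc k) A pA μA≤k | yes (B , pB , μB<μA) = improve k B pB (ℕ.≤-pred (ℕ.<-≤-trans μB<μA μA≤k))

module _ (G : Graph) (S : Scramble G) where

  hits? : ∀ C → Dec (Hits G S C)
  hits? C = All.all? (λ E → any? λ v → (v ∈? E) ×-dec (v ∈? C)) S

  containsEgg? : ∀ A → Dec (ContainsEgg G S A)
  containsEgg? A = Any.any? (λ E → all? λ v → (v ∈? E) →-dec (v ∈? A)) S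

  separates? : ∀ A → Dec (Separates G S A)
  separates? A = containsEgg? A ×-dec containsEgg? (∁ A)

  order-exists : IsScramble G S → ∃ (IsOrder G S)
  order-exists eggs with minimal-subset hits? ∣_∣ | minimal-subset separates? (cut G)
  -- Eggs are nonempty, so the full vertex set hits them all and some hitting set exists.
  ... | inj₁ none | _ =
        contradiction (All.map (λ { ((v , v∈E) , _) → v , v∈E , ∈⊤ }) eggs) (none ⊤)
  ... | inj₂ (C , hits , min) | inj₁ none =
        ∣ C ∣ , ∣ C ∣ , ((C , hits , refl) , min) , inj₁ (none , refl)
  ... | inj₂ (C , hits , min) | inj₂ (A , sep , min′) =
        ∣ C ∣ ℕ.⊓ cut G A , ∣ C ∣ , ((C , hits , refl) , min) , inj₂ (cut G A , ((A , sep , refl) , min′) , refl)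

  order≥ : ∀ {m o} → (∀ C → Hits G S C → m ≤ ∣ C ∣) → (∀ A → Separates G S A → m ≤ cut G A) →
           IsOrder G S o → m ≤ o
  order≥ hits≥ cuts≥ (_ , ((C , hits , refl) , _) , inj₁ (_ , refl)) = hits≥ C hits
  order≥ hits≥ cuts≥ (_ , ((C , hits , refl) , _) , inj₂ (_ , ((A , sep , refl) , _) , refl)) =
    ℕ.⊓-glb (hits≥ C hits) (cuts≥ A sep)

  order≤hits : ∀ {o} → IsOrder G S o → ∀ C → Hits G S C → o ≤ ∣ C ∣
  order≤hits (_ , (_ , min) , inj₁ (_ , refl))     C hits = min C hits
  order≤hits (_ , (_ , min) , inj₂ (_ , _ , refl)) C hits = ℕ.≤-trans (ℕ.m⊓n≤m _ _) (min C hits)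

  order≤cuts : ∀ {o} → IsOrder G S o → ∀ A → Separates G S A → o ≤ cut G A
  order≤cuts (_ , _ , inj₁ (none , _))               A sep = contradiction sep (none A)
  order≤cuts (_ , _ , inj₂ (_ , (_ , min) , refl)) A sep = ℕ.≤-trans (ℕ.m⊓n≤n _ _) (min A sep)

  order≤deg : ∀ {o D} → IsScramble G S → IsOrder G S o → PositiveRank G D → Fin (n G) → + o ℤ.≤ deg G D
  order≤deg {o} {D} eggs order rank v = subst (+ o ℤ.≤_) (sym (∑ℤ≡sum D))
    (ScrambleBound.m≤deg G S eggs (order≤hits order) (order≤cuts order) rank v)

-- Cartesian products

-- Moves the boundary test of `∂` inside the two adjacency cases of `padj`, which gives the form
-- that `sum-cross` expects.
if-+ : ∀ b c d x y → (if b then (if c then x else 0) + (if d then y else 0) else 0)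
     ≡ (if c then (if b then x else 0) else 0) + (if d then (if b then y else 0) else 0)
if-+ true  c     d     x y = refl
if-+ false true  true  x y = refl
if-+ false true  false x y = refl
if-+ false false true  x y = refl
if-+ false false false x y = refl

module Product (G H : Graph) where

  pair : Fin (n G) → Fin (n H) → Fin (n (G □ H))
  pair = combine

  fst : Fin (n (G □ H)) → Fin (n G)
  fst i = proj₁ (remQuot {n G} (n H) i)

  snd : Fin (n (G □ H)) → Fin (n H)
  snd i = proj₂ (remQuot {n G} (n H) i)

  fst-pair : ∀ u v → fst (pair u v) ≡ u
  fst-pair u v = cong proj₁ (remQuot-combine {n G} {n H} u v)

  snd-pair : ∀ u v → snd (pair u v) ≡ v
  snd-pair u v = cong proj₂ (remQuot-combine {n G} {n H} u v)

  pair-fst-snd : ∀ i → pair (fst i) (snd i) ≡ i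
  pair-fst-snd = combine-remQuot {n G} (n H)

  adj-pair : ∀ u v u′ v′ → adj (G □ H) (pair u v) (pair u′ v′) ≡ padj G H u v u′ v′
  adj-pair u v u′ v′ = cong₂ (λ p q → padj G H (proj₁ p) (proj₂ p) (proj₁ q) (proj₂ q))
    (remQuot-combine {n G} {n H} u v) (remQuot-combine {n G} {n H} u′ v′)

  -- Cuts and sizes, copy by copy

  column : Subset (n (G □ H)) → Fin (n G) → Subset (n H)
  column A u = tabulate λ v → lookup A (pair u v)

  row : Subset (n (G □ H)) → Fin (n H) → Subset (n G)
  row A v = tabulate λ u → lookup A (pair u v)

  ∂-pair : ∀ A u v u′ v′ → ∂ (G □ H) A (pair u v) (pair u′ v′)
         ≡ (if does (u ≟ u′) then (if lookup A (pair u v) ∧ not (lookup A (pair u′ v′)) then adj H v v′ else 0) else 0)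
         + (if does (v ≟ v′) then (if lookup A (pair u v) ∧ not (lookup A (pair u′ v′)) then adj G u u′ else 0) else 0)
  ∂-pair A u v u′ v′ rewrite adj-pair u v u′ v′ =
    if-+ (lookup A (pair u v) ∧ not (lookup A (pair u′ v′))) (does (u ≟ u′)) (does (v ≟ v′)) _ _

  sum-∂-pair : ∀ A u v → ℕΣ.sum (∂ (G □ H) A (pair u v))
             ≡ ℕΣ.sum (∂ H (column A u) v) + ℕΣ.sum (∂ G (row A v) u)
  sum-∂-pair A u v = begin
    ℕΣ.sum (∂ (G □ H) A (pair u v))
      ≡⟨ ℕS.sum-combine (n G) (∂ (G □ H) A (pair u v)) ⟩
    (ℕΣ.sum λ u′ → ℕΣ.sum λ v′ → ∂ (G □ H) A (pair u v) (pair u′ v′))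
      ≡⟨ (ℕΣ.sum-cong-≗ λ u′ → ℕΣ.sum-cong-≗ (∂-pair A u v u′)) ⟩
    _ ≡⟨ ℕS.sum-cross u v
           (λ u′ v′ → if lookup A (pair u v) ∧ not (lookup A (pair u′ v′)) then adj H v v′ else 0)
           (λ u′ v′ → if lookup A (pair u v) ∧ not (lookup A (pair u′ v′)) then adj G u u′ else 0) ⟩
    _ ≡⟨ cong₂ _+_ (ℕΣ.sum-cong-≗ H-part) (ℕΣ.sum-cong-≗ G-part) ⟩
    ℕΣ.sum (∂ H (column A u) v) + ℕΣ.sum (∂ G (row A v) u) ∎
    where
    open ≡-Reasoning
    H-part : ∀ v′ → (if lookup A (pair u v) ∧ not (lookup A (pair u v′)) then adj H v v′ else 0) ≡ ∂ H (column A u) v v′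
    H-part v′ rewrite lookup∘tabulate (λ v → lookup A (pair u v)) v
                    | lookup∘tabulate (λ v → lookup A (pair u v)) v′ = refl
    G-part : ∀ u′ → (if lookup A (pair u v) ∧ not (lookup A (pair u′ v)) then adj G u u′ else 0) ≡ ∂ G (row A v) u u′
    G-part u′ rewrite lookup∘tabulate (λ u → lookup A (pair u v)) u
                    | lookup∘tabulate (λ u → lookup A (pair u v)) u′ = refl

  -- Every edge of the product lies in exactly one copy of `H` or one copy of `G`, so the cut is the
  -- sum of the cuts induced on the copies.
  cut-□ : ∀ A → cut (G □ H) A ≡ ℕΣ.sum (λ u → cut H (column A u)) + ℕΣ.sum (λ v → cut G (row A v))
  cut-□ A = begin
    cut (G □ H) A
      ≡⟨ cut≡sum (G □ H) A ⟩
    (ℕΣ.sum λ i → ℕΣ.sum (∂ (G □ H) A i))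
      ≡⟨ ℕS.sum-combine (n G) (λ i → ℕΣ.sum (∂ (G □ H) A i)) ⟩
    (ℕΣ.sum λ u → ℕΣ.sum λ v → ℕΣ.sum (∂ (G □ H) A (pair u v)))
      ≡⟨ (ℕΣ.sum-cong-≗ λ u → trans (ℕΣ.sum-cong-≗ (sum-∂-pair A u)) (ℕΣ.∑-distrib-+ (h u) (g u))) ⟩
    (ℕΣ.sum λ u → ℕΣ.sum (h u) + ℕΣ.sum (g u))
      ≡⟨ ℕΣ.∑-distrib-+ (λ u → ℕΣ.sum (h u)) (λ u → ℕΣ.sum (g u)) ⟩
    (ℕΣ.sum λ u → ℕΣ.sum (h u)) + (ℕΣ.sum λ u → ℕΣ.sum (g u))
      ≡⟨ cong₂ _+_ (ℕΣ.sum-cong-≗ λ u → sym (cut≡sum H (column A u)))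
                   (trans (ℕΣ.∑-comm g) (ℕΣ.sum-cong-≗ λ v → sym (cut≡sum G (row A v)))) ⟩
    ℕΣ.sum (λ u → cut H (column A u)) + ℕΣ.sum (λ v → cut G (row A v)) ∎
    where
    open ≡-Reasoning
    h g : Fin (n G) → Fin (n H) → ℕ
    h u v = ℕΣ.sum (∂ H (column A u) v)
    g u v = ℕΣ.sum (∂ G (row A v) u)

  ∣A∣≡sum-rows : ∀ A → ∣ A ∣ ≡ ℕΣ.sum λ v → ∣ row A v ∣
  ∣A∣≡sum-rows A = begin
    ∣ A ∣                                                    ≡⟨ ∣p∣≡sum A ⟩
    (ℕΣ.sum λ i → ⟦ lookup A i ⟧)                            ≡⟨ ℕS.sum-combine (n G) (λ i → ⟦ lookup A i ⟧) ⟩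
    (ℕΣ.sum λ u → ℕΣ.sum λ v → ⟦ lookup A (pair u v) ⟧)      ≡⟨ ℕΣ.∑-comm (λ u v → ⟦ lookup A (pair u v) ⟧) ⟩
    (ℕΣ.sum λ v → ℕΣ.sum λ u → ⟦ lookup A (pair u v) ⟧)      ≡⟨ ℕΣ.sum-cong-≗ row-size ⟩
    (ℕΣ.sum λ v → ∣ row A v ∣)                               ∎
    where
    open ≡-Reasoning
    row-size : ∀ v → (ℕΣ.sum λ u → ⟦ lookup A (pair u v) ⟧) ≡ ∣ row A v ∣
    row-size v = sym (trans (∣p∣≡sum (row A v))
      (ℕΣ.sum-cong-≗ λ u → cong ⟦_⟧ (lookup∘tabulate (λ u → lookup A (pair u v)) u)))

  -- The Laplacian of the product and divisors pulled back along projections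

  if-*ℤ : ∀ c d x y a → (+ ((if c then x else 0) + (if d then y else 0))) ℤ.* a
        ≡ (if c then + x ℤ.* a else 0ℤ) ℤ.+ (if d then + y ℤ.* a else 0ℤ)
  if-*ℤ true  true  x y a = trans (cong (ℤ._* a) (ℤ.pos-+ x y)) (ℤ.*-distribʳ-+ a (+ x) (+ y))
  if-*ℤ true  false x y a = trans (cong (λ z → + z ℤ.* a) (ℕ.+-identityʳ x)) (sym (ℤ.+-identityʳ _))
  if-*ℤ false true  x y a = sym (ℤ.+-identityˡ _)
  if-*ℤ false false x y a = ℤ.*-zeroˡ a

  Δ-□ : ∀ f u v → Δ (G □ H) f (pair u v)
      ≡ Δ H (λ v′ → f (pair u v′)) v ℤ.+ Δ G (λ u′ → f (pair u′ v)) u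
  Δ-□ f u v = begin
    Δ (G □ H) f (pair u v)
      ≡⟨ ℤS.sum-combine (n G) (λ i → + adj (G □ H) (pair u v) i ℤ.* (f i ℤ.- f (pair u v))) ⟩
    _ ≡⟨ (ℤΣ.sum-cong-≗ λ u′ → ℤΣ.sum-cong-≗ λ v′ → term u′ v′) ⟩
    _ ≡⟨ ℤS.sum-cross u v (λ u′ v′ → + adj H v v′ ℤ.* diff u′ v′) (λ u′ v′ → + adj G u u′ ℤ.* diff u′ v′) ⟩
    Δ H (λ v′ → f (pair u v′)) v ℤ.+ Δ G (λ u′ → f (pair u′ v)) u ∎
    where
    open ≡-Reasoning
    diff : Fin (n G) → Fin (n H) → ℤ
    diff u′ v′ = f (pair u′ v′) ℤ.- f (pair u v)
    term : ∀ u′ v′ → + adj (G □ H) (pair u v) (pair u′ v′) ℤ.* diff u′ v′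
         ≡ (if does (u ≟ u′) then + adj H v v′ ℤ.* diff u′ v′ else 0ℤ)
           ℤ.+ (if does (v ≟ v′) then + adj G u u′ ℤ.* diff u′ v′ else 0ℤ)
    term u′ v′ rewrite adj-pair u v u′ v′ =
      if-*ℤ (does (u ≟ u′)) (does (v ≟ v′)) (adj H v v′) (adj G u u′) (diff u′ v′)

  -- A script pulled back from `G` is constant on each copy of `H`, so only the part along `G`
  -- survives.
  Δ-fst : ∀ f i → Δ (G □ H) (f ∘ fst) i ≡ Δ G f (fst i)
  Δ-fst f i = begin
    Δ (G □ H) (f ∘ fst) i
      ≡⟨ cong (Δ (G □ H) (f ∘ fst)) (pair-fst-snd i) ⟨
    Δ (G □ H) (f ∘ fst) (pair (fst i) (snd i))
      ≡⟨ Δ-□ (f ∘ fst) (fst i) (snd i) ⟩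
    Δ H (λ v → f (fst (pair (fst i) v))) (snd i) ℤ.+ Δ G (λ u → f (fst (pair u (snd i)))) (fst i)
      ≡⟨ cong₂ ℤ._+_
           (trans (Δ-cong H (λ v → cong f (fst-pair (fst i) v)) (snd i)) (Δ-const H (f (fst i)) (snd i)))
           (Δ-cong G (λ u → cong f (fst-pair u (snd i))) (fst i)) ⟩
    0ℤ ℤ.+ Δ G f (fst i)
      ≡⟨ ℤ.+-identityˡ _ ⟩
    Δ G f (fst i) ∎
    where open ≡-Reasoning

  Δ-snd : ∀ f i → Δ (G □ H) (f ∘ snd) i ≡ Δ H f (snd i)
  Δ-snd f i = begin
    Δ (G □ H) (f ∘ snd) i
      ≡⟨ cong (Δ (G □ H) (f ∘ snd)) (pair-fst-snd i) ⟨
    Δ (G □ H) (f ∘ snd) (pair (fst i) (snd i))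
      ≡⟨ Δ-□ (f ∘ snd) (fst i) (snd i) ⟩
    Δ H (λ v → f (snd (pair (fst i) v))) (snd i) ℤ.+ Δ G (λ u → f (snd (pair u (snd i)))) (fst i)
      ≡⟨ cong₂ ℤ._+_
           (Δ-cong H (λ v → cong f (snd-pair (fst i) v)) (snd i))
           (trans (Δ-cong G (λ u → cong f (snd-pair u (snd i))) (fst i)) (Δ-const G (f (snd i)) (fst i))) ⟩
    Δ H f (snd i) ℤ.+ 0ℤ
      ≡⟨ ℤ.+-identityʳ _ ⟩
    Δ H f (snd i) ∎
    where open ≡-Reasoning

  -- The script that makes `D - (π i)` effective on `K` is pulled back. On the product only the
  -- vertex `i` gives up a chip, not its whole fibre, so the result dominates the pullback of an
  -- effective divisor.
  pullback-rank : ∀ {K : Graph} (π : Fin (n (G □ H)) → Fin (n K)) →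
                  (∀ f i → Δ (G □ H) (f ∘ π) i ≡ Δ K f (π i)) →
                  ∀ {D} → PositiveRank K D → PositiveRank (G □ H) (D ∘ π)
  pullback-rank {K} π Δ-π {D} rank i =
    let E , E≥0 , eqv = rank (π i)
        f , E≡        = Equivalent⇒Δ K eqv
        E′ , eqv′ , E′≡ = Realizable.realize (realizable (G □ H) (f ∘ π)) (minusPoint (G □ H) (D ∘ π) i)
    in E′ , (λ j → ℤ.≤-trans (E≥0 (π j)) (ℤ.≤-trans (ℤ.≤-reflexive (E≡ (π j)))
               (ℤ.≤-trans (ℤ.+-mono-≤ (minus≤ j) (ℤ.≤-reflexive (sym (Δ-π f j)))) (ℤ.≤-reflexive (sym (E′≡ j))))))
       , eqv′
    where
    minus≤ : ∀ j → minusPoint K D (π i) (π j) ℤ.≤ minusPoint (G □ H) (D ∘ π) i j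
    minus≤ j with π j ≟ π i | j ≟ i
    ... | yes _    | yes _    = ℤ.≤-refl
    ... | yes _    | no  _    = ℤ.i-j≤i (D (π j)) (+ 1)
    ... | no  _    | no  _    = ℤ.≤-refl
    ... | no πj≢πi | yes refl = contradiction refl πj≢πi

  deg-fst : ∀ D → deg (G □ H) (D ∘ fst) ≡ + n H ℤ.* deg G D
  deg-fst D = begin
    deg (G □ H) (D ∘ fst)                       ≡⟨ ∑ℤ≡sum (D ∘ fst) ⟩
    ℤΣ.sum (D ∘ fst)                            ≡⟨ ℤS.sum-combine (n G) (D ∘ fst) ⟩
    (ℤΣ.sum λ u → ℤΣ.sum λ v → D (fst (pair u v)))
      ≡⟨ (ℤΣ.sum-cong-≗ λ u → trans (ℤΣ.sum-cong-≗ λ v → cong D (fst-pair u v)) (sum-constℤ (n H) (D u))) ⟩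
    (ℤΣ.sum λ u → + n H ℤ.* D u)                ≡⟨ ℤΣ.*-distribˡ-sum (+ n H) D ⟨
    + n H ℤ.* ℤΣ.sum D                          ≡⟨ cong (ℤ._*_ (+ n H)) (∑ℤ≡sum D) ⟨
    + n H ℤ.* deg G D                           ∎
    where open ≡-Reasoning

  deg-snd : ∀ D → deg (G □ H) (D ∘ snd) ≡ + n G ℤ.* deg H D
  deg-snd D = begin
    deg (G □ H) (D ∘ snd)                       ≡⟨ ∑ℤ≡sum (D ∘ snd) ⟩
    ℤΣ.sum (D ∘ snd)                            ≡⟨ ℤS.sum-combine (n G) (D ∘ snd) ⟩
    (ℤΣ.sum λ u → ℤΣ.sum λ v → D (snd (pair u v)))
      ≡⟨ (ℤΣ.sum-cong-≗ λ u → ℤΣ.sum-cong-≗ λ v → cong D (snd-pair u v)) ⟩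
    (ℤΣ.sum {n G} λ u → ℤΣ.sum D)               ≡⟨ sum-constℤ (n G) (ℤΣ.sum D) ⟩
    + n G ℤ.* ℤΣ.sum D                          ≡⟨ cong (ℤ._*_ (+ n G)) (∑ℤ≡sum D) ⟨
    + n G ℤ.* deg H D                           ∎
    where open ≡-Reasoning

-- The scramble on the product

allSubsets : ∀ m → List (Subset m)
allSubsets zero    = Vec.[] ∷ []
allSubsets (suc m) = map (Vec._∷_ inside) (allSubsets m) ++ map (Vec._∷_ outside) (allSubsets m)

∈-allSubsets : ∀ {m} (p : Subset m) → p List.∈ allSubsets m
∈-allSubsets Vec.[]              = Any.here refl
∈-allSubsets (inside  Vec.∷ p) = List.∈-++⁺ˡ (List.∈-map⁺ (Vec._∷_ inside) (∈-allSubsets p))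
∈-allSubsets {suc m} (outside Vec.∷ p) =
  List.∈-++⁺ʳ (map (Vec._∷_ inside) (allSubsets m)) (List.∈-map⁺ (Vec._∷_ outside) (∈-allSubsets p))

-- On at most one vertex the edge-connectivity is 0 by convention and the bound is trivial.
edge-cut≥ : ∀ {G l} → IsEdgeConnectivity G l → ∀ A → ProperNonempty G A → l ≤ cut G A
edge-cut≥ (inj₁ (_ , refl))      A _      = z≤n
edge-cut≥ (inj₂ (_ , _ , least)) A proper = least A proper

module ProductScramble (G H : Graph) {k λG λH : ℕ}
    (k<n  : k < n G)
    (conn : ∀ X → ∣ X ∣ < k → InducesConnected G (∁ X))
    (2k-1≤n : 2 * k ∸ 1 ≤ n G)
    (λG≤cut : ∀ A → ProperNonempty G A → λG ≤ cut G A)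
    (λH≤cut : ∀ A → ProperNonempty H A → λH ≤ cut H A)
    (⟨k-1⟩λH≤λG : (k ∸ 1) * λH ≤ λG) where

  open Product G H

  egg : Subset (n G) → Fin (n H) → Subset (n (G □ H))
  egg X v = tabulate λ i → lookup (∁ X) (fst i) ∧ does (snd i ≟ v)

  small? : ∀ (X : Subset (n G)) → Dec (∣ X ∣ < k)
  small? X = ∣ X ∣ ℕ.<? k

  S : Scramble (G □ H)
  S = cartesianProductWith egg (filter small? (allSubsets (n G))) (allFin (n H))

  egg∈S : ∀ {X} v → ∣ X ∣ < k → egg X v List.∈ S
  egg∈S {X} v small = List.∈-cartesianProductWith⁺ egg (List.∈-filter⁺ small? (∈-allSubsets X) small) (List.∈-allFin v)

  S⇒egg : ∀ {E} → E List.∈ S → ∃ λ X → ∃ λ v → ∣ X ∣ < k × E ≡ egg X v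
  S⇒egg E∈S with List.∈-cartesianProductWith⁻ egg (filter small? (allSubsets (n G))) (allFin (n H)) E∈S
  ... | X , v , X∈ , _ , E≡ = X , v , proj₂ (List.∈-filter⁻ small? {xs = allSubsets (n G)} X∈) , E≡

  ∈-egg⁺ : ∀ {X u} v → u ∈ ∁ X → pair u v ∈ egg X v
  ∈-egg⁺ {X} {u} v u∈ = ∈-tabulate⁺ inEgg
    where
    inEgg : lookup (∁ X) (fst (pair u v)) ∧ does (snd (pair u v) ≟ v) ≡ true
    inEgg rewrite fst-pair u v | snd-pair u v | []=⇒lookup u∈ = dec-true (v ≟ v) refl

  ∈-egg⁻ : ∀ {X v i} → i ∈ egg X v → fst i ∈ ∁ X × i ≡ pair (fst i) v
  ∈-egg⁻ {X} {v} {i} i∈ with inside⊎outside (∁ X) (fst i) | snd i ≟ v | ∈-tabulate⁻ i∈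
  ... | inj₁ u∈ | yes refl | _ = u∈ , sym (pair-fst-snd i)
  ... | inj₁ u∈ | no  _    | t = contradiction (trans (sym t) (cong (_∧ false) ([]=⇒lookup u∈))) λ ()
  ... | inj₂ u∉ | d        | t = contradiction (trans (sym t) (cong (_∧ does d) u∉)) λ ()

  lift-edge : ∀ {u u′} v → 0 < adj G u u′ → 0 < adj (G □ H) (pair u v) (pair u′ v)
  lift-edge {u} {u′} v e rewrite adj-pair u v u′ v | dec-true (v ≟ v) refl = ℕ.<-≤-trans e (ℕ.m≤n+m _ _)

  lift-reach : ∀ {X u u′} v → Reach G (∁ X) u u′ → Reach (G □ H) (egg X v) (pair u v) (pair u′ v)
  lift-reach v (here u∈)     = here (∈-egg⁺ v u∈)
  lift-reach v (step u∈ e r) = step (∈-egg⁺ v u∈) (lift-edge v e) (lift-reach v r)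

  egg-connected : ∀ X v → ∣ X ∣ < k → InducesConnected (G □ H) (egg X v)
  egg-connected X v small = let (u , u∈) , reach = conn X small in
    (pair u v , ∈-egg⁺ v u∈) , λ i j i∈ j∈ →
      let u∈ , i≡ = ∈-egg⁻ i∈
          u′∈ , j≡ = ∈-egg⁻ j∈
      in subst₂ (Reach (G □ H) (egg X v)) (sym i≡) (sym j≡) (lift-reach v (reach _ _ u∈ u′∈))

  S-isScramble : IsScramble (G □ H) S
  S-isScramble = All.tabulate λ E∈S → let X , v , small , E≡ = S⇒egg E∈S in
    subst (InducesConnected (G □ H)) (sym E≡) (egg-connected X v small)

  ∈-row⁺ : ∀ {A u v} → pair u v ∈ A → u ∈ row A v
  ∈-row⁺ = ∈-tabulate⁺ ∘ []=⇒lookup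

  -- If `C` had fewer than `k` vertices in the copy of `G` at `v`, these could serve as the removed
  -- set `X`, and the egg left over would avoid `C`.
  hits≥ : ∀ C → Hits (G □ H) S C → k * n H ≤ ∣ C ∣
  hits≥ C hits = begin
    k * n H                        ≡⟨ ℕ.*-comm k (n H) ⟩
    n H * k                        ≡⟨ sum-const (n H) k ⟨
    ℕΣ.sum {n H} (λ _ → k)         ≤⟨ sum-mono row≥k ⟩
    ℕΣ.sum (λ v → ∣ row C v ∣)     ≡⟨ ∣A∣≡sum-rows C ⟨
    ∣ C ∣                          ∎
    where
    open ℕ.≤-Reasoning
    row≥k : ∀ v → k ≤ ∣ row C v ∣
    row≥k v = ℕ.≮⇒≥ λ small →
      let i , i∈E , i∈C = All.lookup hits (egg∈S {row C v} v small)
          u∈∁ , i≡      = ∈-egg⁻ i∈E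
      in x∈∁p⇒x∉p u∈∁ (∈-row⁺ (subst (_∈ C) i≡ i∈C))

  contained : ∀ {A} → ContainsEgg (G □ H) S A → ∃ λ X → ∃ λ v → ∣ X ∣ < k × (∀ u → u ∈ ∁ X → pair u v ∈ A)
  contained has with List.find has
  ... | E , E∈S , E⊆A with S⇒egg E∈S
  ...   | X , v , small , refl = X , v , small , λ u u∈ → E⊆A (pair u v) (∈-egg⁺ v u∈)

  -- A column of G □ H not cut by A is full or empty, which happens for at most k − 1 columns each:
  -- the row through one egg bounds the empty columns, the row through the other egg the full ones.
  -- Each of these rows is cut as soon as the number it bounds is positive, and then pays λ(G).
  cuts≥ : ∀ A → Separates (G □ H) S A → n G * λH ≤ cut (G □ H) A
  cuts≥ A (has , has∁) with contained has | contained has∁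
  ... | X , v , X-small , X⊆A | Y , w , Y-small , Y⊆∁A = begin
      n G * λH
        ≡⟨ sum-const (n G) λH ⟨
      ℕΣ.sum {n G} (λ _ → λH)
        ≤⟨ sum-mono column-bound ⟩
      ℕΣ.sum (λ u → cut H (column A u) + (full u * λH + empty u * λH))
        ≡⟨ split ⟩
      columns + (ℕΣ.sum full * λH + ℕΣ.sum empty * λH)
        ≤⟨ ℕ.+-monoʳ-≤ columns (ℕ.+-mono-≤ row-w row-v) ⟩
      columns + (cut G (row A w) + cut G (row A v))
        ≤⟨ ℕ.+-monoʳ-≤ columns (terms≤sum (λ v → cut G (row A v)) (v≢w ∘ sym)) ⟩
      columns + ℕΣ.sum (λ v → cut G (row A v))
        ≡⟨ cut-□ A ⟨
      cut (G □ H) A ∎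
    where
    open ℕ.≤-Reasoning

    columns : ℕ
    columns = ℕΣ.sum λ u → cut H (column A u)

    full empty : Fin (n G) → ℕ
    full  u = ⟦ not (does (nonempty? (∁ (column A u)))) ⟧
    empty u = ⟦ not (does (nonempty? (column A u))) ⟧

    -- A properly cut column pays `λH` itself. For an uncut one the missing `λH` is recorded as a
    -- debt in `full` or `empty`, to be settled by the rows `w` and `v`.
    column-bound : ∀ u → λH ≤ cut H (column A u) + (full u * λH + empty u * λH)
    column-bound u with nonempty? (∁ (column A u)) | nonempty? (column A u)
    ... | no _   | none?   = ℕ.≤-trans
      (ℕ.≤-trans (ℕ.≤-reflexive (sym (ℕ.*-identityˡ λH))) (ℕ.m≤m+n (1 * λH) (⟦ not (does none?) ⟧ * λH)))
      (ℕ.m≤n+m _ (cut H (column A u)))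
    ... | yes _  | no _    = ℕ.≤-trans (ℕ.≤-reflexive (sym (ℕ.*-identityˡ λH))) (ℕ.m≤n+m (1 * λH) (cut H (column A u)))
    ... | yes ne | yes ne′ = ℕ.≤-trans (λH≤cut (column A u) (ne′ , ne)) (ℕ.m≤m+n _ _)

    split : ℕΣ.sum (λ u → cut H (column A u) + (full u * λH + empty u * λH))
          ≡ columns + (ℕΣ.sum full * λH + ℕΣ.sum empty * λH)
    split = trans (ℕΣ.∑-distrib-+ (λ u → cut H (column A u)) _)
      (cong (columns ℕ.+_) (trans (ℕΣ.∑-distrib-+ (λ u → full u * λH) _)
        (cong₂ _+_ (sym (ℕΣ.*-distribʳ-sum λH full)) (sym (ℕΣ.*-distribʳ-sum λH empty)))))

    v≢w : v ≢ w
    -- Two eggs in the same copy of `G` are disjoint only if `X` and `Y` together cover `G`, which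
    -- is too large for that.
    v≢w refl = ℕ.<⇒≱ 2k-2<n (begin
      n G                                                            ≡⟨ trans (sum-const (n G) 1) (ℕ.*-identityʳ (n G)) ⟨
      ℕΣ.sum {n G} (λ _ → 1)                                         ≤⟨ sum-mono covered ⟩
      ℕΣ.sum (λ u → ⟦ lookup X u ⟧ + ⟦ lookup Y u ⟧)                 ≡⟨ ℕΣ.∑-distrib-+ (λ u → ⟦ lookup X u ⟧) _ ⟩
      ℕΣ.sum (λ u → ⟦ lookup X u ⟧) + ℕΣ.sum (λ u → ⟦ lookup Y u ⟧)  ≡⟨ cong₂ _+_ (∣p∣≡sum X) (∣p∣≡sum Y) ⟨
      ∣ X ∣ + ∣ Y ∣                                                  ∎)
      where
      covered : ∀ u → 1 ≤ ⟦ lookup X u ⟧ + ⟦ lookup Y u ⟧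
      covered u with inside⊎outside X u | inside⊎outside Y u
      ... | inj₁ u∈X | _ rewrite []=⇒lookup u∈X = s≤s z≤n
      ... | inj₂ _   | inj₁ u∈Y rewrite []=⇒lookup u∈Y = ℕ.m≤n+m 1 _
      ... | inj₂ u∉X | inj₂ u∉Y = contradiction (X⊆A u (false⇒∈∁ u∉X)) (x∈∁p⇒x∉p (Y⊆∁A u (false⇒∈∁ u∉Y)))
      2k-2<n : ∣ X ∣ + ∣ Y ∣ < n G
      -- Both sets have at most `k - 1` elements, so their sizes plus 2 are at most `2 * k`;
      -- dropping 1 on each side leaves the strict inequality.
      2k-2<n = ℕ.≤-trans (ℕ.∸-monoˡ-≤ 1 (ℕ.≤-trans
        (ℕ.≤-reflexive (cong suc (sym (ℕ.+-suc ∣ X ∣ ∣ Y ∣))))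
        (ℕ.≤-trans (ℕ.+-mono-≤ X-small Y-small) (ℕ.≤-reflexive (cong (k ℕ.+_) (sym (ℕ.+-identityʳ k))))))) 2k-1≤n

    -- Here `j` counts the uncut columns charged to row `z`. If there are any, their debt is at most
    -- `(k ∸ 1) * λH`, hence at most `λG`, which a properly cut row pays.
    row-cut : ∀ {j} z → j ≤ k ∸ 1 → (0 < j → ProperNonempty G (row A z)) → j * λH ≤ cut G (row A z)
    row-cut {zero}  z j≤ proper = z≤n
    row-cut {suc j} z j≤ proper = ℕ.≤-trans (ℕ.*-monoˡ-≤ λH j≤)
      (ℕ.≤-trans ⟨k-1⟩λH≤λG (λG≤cut (row A z) (proper (s≤s z≤n))))

    small-sum : ∀ {p : Subset (n G)} {f : Fin (n G) → ℕ} → ∣ p ∣ < k → (∀ u → f u ≤ ⟦ lookup p u ⟧) → ℕΣ.sum f ≤ k ∸ 1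
    small-sum {p} small f≤ = ℕ.≤-trans (sum-mono f≤)
      (ℕ.≤-trans (ℕ.≤-reflexive (sym (∣p∣≡sum p))) (ℕ.∸-monoˡ-≤ 1 small))

    positive-term : ∀ {m} (f : Fin m → ℕ) → 0 < ℕΣ.sum f → ∃ λ u → 0 < f u
    positive-term {suc m} f 0<sum with f zero in eq
    ... | suc _ = zero , subst (0 <_) (sym eq) (s≤s z≤n)
    ... | zero  = let u , 0<fu = positive-term (f ∘ suc) 0<sum in suc u , 0<fu

    full⇒ : ∀ u → 0 < full u → ∀ z → pair u z ∈ A
    full⇒ u 0<full z with nonempty? (∁ (column A u)) | inside⊎outside A (pair u z)
    ... | no _   | inj₁ uz∈A = uz∈A
    ... | no all | inj₂ uz∉A = contradiction (z , false⇒∈∁ (trans (lookup∘tabulate (λ z → lookup A (pair u z)) z) uz∉A)) all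

    empty⇒ : ∀ u → 0 < empty u → ∀ z → lookup A (pair u z) ≡ false
    empty⇒ u 0<empty z with nonempty? (column A u) | inside⊎outside A (pair u z)
    ... | no _    | inj₂ uz∉A = uz∉A
    ... | no none | inj₁ uz∈A = contradiction (z , ∈-tabulate⁺ ([]=⇒lookup uz∈A)) none

    bit≤ : ∀ b {c} → (0 < ⟦ b ⟧ → c ≡ true) → ⟦ b ⟧ ≤ ⟦ c ⟧
    bit≤ false _   = z≤n
    bit≤ true  imp = ℕ.≤-reflexive (cong ⟦_⟧ (sym (imp (s≤s z≤n))))

    outside-row : ∀ {u z} → lookup A (pair u z) ≡ false → u ∈ ∁ (row A z)
    outside-row {u} {z} eq = false⇒∈∁ (trans (lookup∘tabulate (λ u → lookup A (pair u z)) u) eq)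

    inA⇒inY : ∀ u → pair u w ∈ A → lookup Y u ≡ true
    inA⇒inY u uw∈A with inside⊎outside Y u
    ... | inj₁ u∈Y = []=⇒lookup u∈Y
    ... | inj₂ u∉Y = contradiction uw∈A (x∈∁p⇒x∉p (Y⊆∁A u (false⇒∈∁ u∉Y)))

    notInA⇒inX : ∀ u → lookup A (pair u v) ≡ false → lookup X u ≡ true
    notInA⇒inX u uv∉A with inside⊎outside X u
    ... | inj₁ u∈X = []=⇒lookup u∈X
    ... | inj₂ u∉X = contradiction (trans (sym ([]=⇒lookup (X⊆A u (false⇒∈∁ u∉X)))) uv∉A) λ ()

    row-w : ℕΣ.sum full * λH ≤ cut G (row A w)
    row-w = row-cut w
      -- A full column meets row `w` in `A`, where the egg avoiding `A` leaves room only over `Y`.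
      (small-sum {Y} {full} Y-small λ u → bit≤ (not (does (nonempty? (∁ (column A u))))) λ f → inA⇒inY u (full⇒ u f w))
      λ 0<sum →
        let u , 0<full   = positive-term full 0<sum
            -- The egg over the complement of `Y` is nonempty, which gives a vertex of row `w`
            -- outside `A`.
            (u′ , u′∈) , _ = conn Y Y-small
        in (u , ∈-row⁺ (full⇒ u 0<full w)) , (u′ , x∉p⇒x∈∁p λ u′∈row →
             x∈∁p⇒x∉p (Y⊆∁A u′ u′∈) (lookup⇒[]= _ A (∈-tabulate⁻ u′∈row)))

    row-v : ℕΣ.sum empty * λH ≤ cut G (row A v)
    row-v = row-cut v
      (small-sum {X} {empty} X-small λ u → bit≤ (not (does (nonempty? (column A u)))) λ e → notInA⇒inX u (empty⇒ u e v))
      λ 0<sum →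
        let u , 0<empty  = positive-term empty 0<sum
            (u′ , u′∈) , _ = conn X X-small
        in (u′ , ∈-row⁺ (X⊆A u′ u′∈)) , (u , outside-row (empty⇒ u 0<empty v))

  -- A sandwich: the order of `S` is at least `N`, every scramble order is at most the degree of
  -- every divisor of positive rank, and `D` has degree `N`.
  sn≡gon : ∀ {N D} → N ≤ k * n H → N ≤ n G * λH → Fin (n (G □ H)) →
           PositiveRank (G □ H) D → deg (G □ H) D ≡ + N →
           IsScrambleNumber (G □ H) N × IsGonality (G □ H) N
  sn≡gon {N} {D} N≤kn N≤nλ i rank deg≡N = let o , order = order-exists (G □ H) S S-isScramble in
    conclude o order
    where
    conclude : ∀ o → IsOrder (G □ H) S o → IsScrambleNumber (G □ H) N × IsGonality (G □ H) N
    conclude o order =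
      ((S , S-isScramble , subst (IsOrder (G □ H) S) o≡N order) , ≤N)
      , ((D , rank , deg≡N)
        , λ D′ rank′ → ℤ.≤-trans (ℤ.+≤+ N≤o) (order≤deg (G □ H) S S-isScramble order rank′ i))
      where
      ≤N : ∀ S′ o′ → IsScramble (G □ H) S′ → IsOrder (G □ H) S′ o′ → o′ ≤ N
      ≤N S′ o′ eggs′ order′ =
        ℤ.drop‿+≤+ (subst (+ o′ ℤ.≤_) deg≡N (order≤deg (G □ H) S′ eggs′ order′ rank i))
      N≤o : N ≤ o
      N≤o = order≥ (G □ H) S (λ C hits → ℕ.≤-trans N≤kn (hits≥ C hits)) (λ A sep → ℕ.≤-trans N≤nλ (cuts≥ A sep)) order
      o≡N : o ≡ N
      o≡N = ℕ.≤-antisym (≤N S o S-isScramble order) N≤o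

theorem5p10 : (G H : Graph) → Connected G → Connected H →
    (k κG λG λH : ℕ) →
    IsVertexConnectivity G κG → IsEdgeConnectivity G λG → IsEdgeConnectivity H λH →
    1 ≤ k → k ≤ κG → 2 * k ∸ 1 ≤ ∣V∣ G → (k ∸ 1) * λH ≤ λG →
    ((k * ∣V∣ H ≤ ∣V∣ G * λH → IsGonality G k →
    IsScrambleNumber (G □ H) (k * ∣V∣ H) × IsGonality (G □ H) (k * ∣V∣ H))
    × (∣V∣ G * λH ≤ k * ∣V∣ H → IsGonality H λH →
    IsScrambleNumber (G □ H) (∣V∣ G * λH) × IsGonality (G □ H) (∣V∣ G * λH)))
theorem5p10 G H ((u , _) , _) ((v , _) , _) k κG λG λH ((κ<n , conn) , _) isλG isλH 1≤k k≤κ 2k-1≤n λ≤ =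
  -- A divisor of degree `k` on `G` is repeated on each of the `n H` copies of `G`.
  (λ kn≤nλ ((D , rank , deg≡k) , _) →
     sn≡gon ℕ.≤-refl kn≤nλ (pair u v) (pullback-rank {G} fst Δ-fst rank)
       (trans (deg-fst D) (trans (cong (ℤ._*_ (+ n H)) deg≡k)
         (trans (sym (ℤ.pos-* (n H) k)) (cong +_ (ℕ.*-comm (n H) k))))))
  -- A divisor of degree `λH` on `H` is repeated on each of the `n G` copies of `H`.
  , (λ nλ≤kn ((D , rank , deg≡λ) , _) →
     sn≡gon nλ≤kn ℕ.≤-refl (pair u v) (pullback-rank {H} snd Δ-snd rank)
       (trans (deg-snd D) (trans (cong (ℤ._*_ (+ n G)) deg≡λ) (sym (ℤ.pos-* (n G) λH)))))
  where
  open Product G H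
  open ProductScramble G H (ℕ.≤-<-trans k≤κ κ<n) (λ X small → conn X (ℕ.<-≤-trans small k≤κ))
    2k-1≤n (edge-cut≥ {G} isλG) (edge-cut≥ {H} isλH) λ≤
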